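{- Fix an integer $k\ge 2$. Let $\xi(m,r,s,u)$ be the formal power series in $r$ satisfying $$f(rs)\,\xi(m,r,s,u)=1+rs(m-1)\prod_{j=0}^{k-1}\xi(m,rs^{j},s,u)-mrsu\prod_{j=0}^{k}\xi(m,rs^{j},s,u),$$ where $f(x)=1+x(m-1)$. Then $$\xi(m,r,s,u)=\sum_{n\ge 0}(-rs)^{n}\sum_{\mu\in\mathtt{Dyck}(n;k)}s^{|Y(\mu_{0}/\mu)|}\,\mathrm{wt}^{II}(k;\mu).$$
   Context: $m,s,u$ are formal variables, $m'=m-1$, $u'=u-1$, and power series in $r$ have coefficients in $\mathbb{Z}[m,s,u]$. A $k$-Dyck path of size $n$ is a lattice path from $(0,0)$ to $(kn,n)$ consisting of up steps $U=(0,1)$ and down steps $D=(1,0)$ which never goes below the line $y=x/k$; $\mathtt{Dyck}(n;k)$ is the set of them. $\mu_0=(UD^k)^n$ is the lowest path, and $|Y(\mu_0/\mu)|$ is the number of unit boxes above $\mu_0$ and below $\mu$. A valley of $\mu$ is an occurrence of the pattern $DU$; the size $|v|$ of a valley $v$ is the maximal $p$ such that $\mu$ has the pattern $D^{p}U$ (consecutive steps) at $v$. $\mathrm{Val}^{II}(k;\mu)$ is the number of valleys $v$ of $\mu$ with $0<|v|\le k-1$. For $\mu\in\mathtt{Dyck}(n;k)$, $$\mathrm{wt}^{II}(k;\mu)=(m'+1)^{n-\mathrm{Val}^{II}(k;\mu)}(u'+1)^{n-\mathrm{Val}^{II}(k;\mu)}(m'u'+u'+1)^{\mathrm{Val}^{II}(k;\mu)}.$$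 -}

module Defs where

open import Level using (0ℓ; _⊔_)
open import Algebra.Bundles using (CommutativeRing)
open import Data.Nat as ℕ using (ℕ; zero; suc; z≤n; s≤s)
import Data.Nat.Properties as ℕₚ
import Data.Integer.Properties as ℤₚ
open import Data.List.Base
  using (List; []; _∷_; _++_; map; foldr; filter; length; concat; replicate; applyUpTo; upTo; inits; cartesianProduct)
open import Data.List.Relation.Unary.All using (All; all?)
open import Data.Product.Base using (Σ-syntax; ∃-syntax; _×_; _,_; proj₁; proj₂)
open import Relation.Nullary.Decidable using (Dec; _×-dec_; map′)
open import Relation.Binary.PropositionalEquality.Core using (_≡_)
import Algebra.Properties.Semiring.Exp as Exp
import Relation.Binary.Reasoning.Setoid as SetoidReasoning

------------------------------------------------------------------------
-- Formal power series over a commutative ring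

module Series {c ℓ} (R : CommutativeRing c ℓ) where

  open CommutativeRing R hiding (ring)
  open SetoidReasoning setoid

  -- n ↦ coefficient of the n-th power of the variable
  Seq : Set c
  Seq = ℕ → Carrier

  infix 4 _≋_
  _≋_ : Seq → Seq → Set ℓ
  f ≋ g = ∀ n → f n ≈ g n

  tail : Seq → Seq
  tail f n = f (suc n)

  -- The Cauchy product, f 0 * g n + f 1 * g (n - 1) + … + f n * g 0
  conv : Seq → Seq → Seq
  conv f g zero    = f 0 * g 0
  conv f g (suc n) = f 0 * g (suc n) + conv (tail f) g n

  zeroˢ : Seq
  zeroˢ _ = 0#

  const : Carrier → Seq
  const a zero    = a
  const a (suc _) = 0#

  var : Seq
  var 0             = 0#
  var 1             = 1#
  var (suc (suc _)) = 0#

  addˢ : Seq → Seq → Seq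
  addˢ f g n = f n + g n

  negˢ : Seq → Seq
  negˢ f n = - f n

  conv-cong : ∀ {f f′ g g′} → f ≋ f′ → g ≋ g′ → conv f g ≋ conv f′ g′
  conv-cong p q zero    = *-cong (p 0) (q 0)
  conv-cong p q (suc n) =
    +-cong (*-cong (p 0) (q (suc n))) (conv-cong (λ i → p (suc i)) q n)

  conv-zeroˡ : ∀ {f} g n → (∀ i → f i ≈ 0#) → conv f g n ≈ 0#
  conv-zeroˡ g zero    p = trans (*-congʳ (p 0)) (zeroˡ _)
  conv-zeroˡ g (suc n) p =
    trans (+-cong (trans (*-congʳ (p 0)) (zeroˡ _)) (conv-zeroˡ g n (λ i → p (suc i))))
          (+-identityˡ 0#)

  interchange : ∀ a b x y → (a + b) + (x + y) ≈ (a + x) + (b + y)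
  interchange a b x y = begin
    (a + b) + (x + y) ≈⟨ +-assoc a b (x + y) ⟩
    a + (b + (x + y)) ≈⟨ +-congˡ (+-assoc b x y) ⟨
    a + ((b + x) + y) ≈⟨ +-congˡ (+-congʳ (+-comm b x)) ⟩
    a + ((x + b) + y) ≈⟨ +-congˡ (+-assoc x b y) ⟩
    a + (x + (b + y)) ≈⟨ +-assoc a x (b + y) ⟨
    (a + x) + (b + y) ∎

  conv-distribʳ : ∀ h f g → conv (addˢ f g) h ≋ addˢ (conv f h) (conv g h)
  conv-distribʳ h f g zero    = distribʳ (h 0) (f 0) (g 0)
  conv-distribʳ h f g (suc n) =
    trans (+-cong (distribʳ _ _ _) (conv-distribʳ h (tail f) (tail g) n))
          (interchange _ _ _ _)

  conv-scaleˡ : ∀ a f g n → conv (λ i → a * f i) g n ≈ a * conv f g n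
  conv-scaleˡ a f g zero    = *-assoc _ _ _
  conv-scaleˡ a f g (suc n) =
    trans (+-cong (*-assoc _ _ _) (conv-scaleˡ a (tail f) g n))
          (sym (distribˡ _ _ _))

  conv-last : ∀ f g n → conv f g (suc n) ≈ conv f (tail g) n + f (suc n) * g 0
  conv-last f g zero    = refl
  conv-last f g (suc n) =
    trans (+-congˡ (conv-last (tail f) g n)) (sym (+-assoc _ _ _))

  conv-comm : ∀ f g → conv f g ≋ conv g f
  conv-comm f g zero    = *-comm _ _
  conv-comm f g (suc n) = begin
    f 0 * g (suc n) + conv (tail f) g n ≈⟨ +-cong (*-comm _ _) (conv-comm (tail f) g n) ⟩
    g (suc n) * f 0 + conv g (tail f) n ≈⟨ +-comm _ _ ⟩
    conv g (tail f) n + g (suc n) * f 0 ≈⟨ conv-last g f n ⟨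
    conv g f (suc n)                    ∎

  conv-assoc : ∀ f g h → conv (conv f g) h ≋ conv f (conv g h)
  conv-assoc f g h zero    = *-assoc _ _ _
  conv-assoc f g h (suc n) = begin
    (f 0 * g 0) * h (suc n) + conv (tail (conv f g)) h n
      ≈⟨ +-cong (*-assoc _ _ _) (conv-distribʳ h (λ i → f 0 * g (suc i)) (conv (tail f) g) n) ⟩
    f 0 * (g 0 * h (suc n)) + (conv (λ i → f 0 * g (suc i)) h n + conv (conv (tail f) g) h n)
      ≈⟨ +-congˡ (+-cong (conv-scaleˡ (f 0) (tail g) h n) (conv-assoc (tail f) g h n)) ⟩
    f 0 * (g 0 * h (suc n)) + (f 0 * conv (tail g) h n + conv (tail f) (conv g h) n)
      ≈⟨ +-assoc _ _ _ ⟨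
    (f 0 * (g 0 * h (suc n)) + f 0 * conv (tail g) h n) + conv (tail f) (conv g h) n
      ≈⟨ +-congʳ (distribˡ _ _ _) ⟨
    f 0 * conv g h (suc n) + conv (tail f) (conv g h) n ∎

  conv-identityˡ : ∀ g → conv (const 1#) g ≋ g
  conv-identityˡ g zero    = *-identityˡ _
  conv-identityˡ g (suc n) =
    trans (+-cong (*-identityˡ _) (conv-zeroˡ g n (λ _ → refl))) (+-identityʳ _)

  conv-identityʳ : ∀ g → conv g (const 1#) ≋ g
  conv-identityʳ g n = trans (conv-comm g (const 1#) n) (conv-identityˡ g n)

  conv-distribˡ : ∀ h f g → conv h (addˢ f g) ≋ addˢ (conv h f) (conv h g)
  conv-distribˡ h f g n = begin
    conv h (addˢ f g) n     ≈⟨ conv-comm h (addˢ f g) n ⟩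
    conv (addˢ f g) h n     ≈⟨ conv-distribʳ h f g n ⟩
    conv f h n + conv g h n ≈⟨ +-cong (conv-comm f h n) (conv-comm g h n) ⟩
    conv h f n + conv h g n ∎

  ring : CommutativeRing c ℓ
  ring = record
    { Carrier = Seq
    ; _≈_ = _≋_
    ; _+_ = addˢ
    ; _*_ = conv
    ; -_  = negˢ
    ; 0#  = zeroˢ
    ; 1#  = const 1#
    ; isCommutativeRing = record
      { isRing = record
        { +-isAbelianGroup = record
          { isGroup = record
            { isMonoid = record
              { isSemigroup = record
                { isMagma = record
                  { isEquivalence = record
                    { refl  = λ _ → refl
                    ; sym   = λ p n → sym (p n)
                    ; trans = λ p q n → trans (p n) (q n)
                    }
                  ; ∙-cong = λ p q n → +-cong (p n) (q n)
                  }
                ; assoc = λ f g h n → +-assoc (f n) (g n) (h n)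
                }
              ; identity = (λ f n → +-identityˡ (f n)) , (λ f n → +-identityʳ (f n))
              }
            ; inverse = (λ f n → -‿inverseˡ (f n)) , (λ f n → -‿inverseʳ (f n))
            ; ⁻¹-cong = λ p n → -‿cong (p n)
            }
          ; comm = λ f g n → +-comm (f n) (g n)
          }
        ; *-cong     = conv-cong
        ; *-assoc    = conv-assoc
        ; *-identity = conv-identityˡ , conv-identityʳ
        ; distrib    = conv-distribˡ , conv-distribʳ
        }
      ; *-comm = conv-comm
      }
    }

------------------------------------------------------------------------
-- Univariate polynomials: the power series with finitely many non-zero
-- coefficients

module Poly {c ℓ} (R : CommutativeRing c ℓ) where

  open CommutativeRing R hiding (ring)
  open Series R using (Seq; conv; tail; zeroˢ; addˢ; negˢ; conv-zeroˡ) renaming (const to constˢ; var to varˢ)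
  private module S = CommutativeRing (Series.ring R)
  open import Algebra.Properties.Ring (CommutativeRing.ring R) using (-0#≈0#)

  Bounded : ℕ → Seq → Set ℓ
  Bounded N f = ∀ n → N ℕ.≤ n → f n ≈ 0#

  Polynomial : Set (c ⊔ ℓ)
  Polynomial = Σ[ f ∈ Seq ] ∃[ N ] Bounded N f

  const : Carrier → Polynomial
  const a = constˢ a , 1 , λ { (suc _) _ → refl }

  var : Polynomial
  var = varˢ , 2 , λ { (suc (suc _)) _ → refl ; (suc zero) (s≤s ()) }

  addᵖ : Polynomial → Polynomial → Polynomial
  addᵖ (f , N , p) (g , M , q) = addˢ f g , N ℕ.+ M , λ n N+M≤n →
    trans (+-cong (p n (ℕₚ.m+n≤o⇒m≤o N N+M≤n)) (q n (ℕₚ.m+n≤o⇒n≤o N N+M≤n)))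
          (+-identityˡ 0#)

  negᵖ : Polynomial → Polynomial
  negᵖ (f , N , p) = negˢ f , N , λ n N≤n → trans (-‿cong (p n N≤n)) -0#≈0#

  conv-bounded : ∀ N M f g → Bounded N f → Bounded M g → Bounded (N ℕ.+ M) (conv f g)
  conv-bounded zero    M f g p q n       _           = conv-zeroˡ g n (λ i → p i z≤n)
  conv-bounded (suc N) M f g p q (suc n) (s≤s N+M≤n) =
    trans (+-cong (trans (*-congˡ (q (suc n) (ℕₚ.m≤n⇒m≤1+n (ℕₚ.m+n≤o⇒n≤o N N+M≤n)))) (zeroʳ _))
                  (conv-bounded N M (tail f) g (λ i N≤i → p (suc i) (s≤s N≤i)) q n N+M≤n))
          (+-identityˡ 0#)

  mulᵖ : Polynomial → Polynomial → Polynomial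
  mulᵖ (f , N , p) (g , M , q) = conv f g , N ℕ.+ M , conv-bounded N M f g p q

  ring : CommutativeRing (c ⊔ ℓ) ℓ
  ring = record
    { Carrier = Polynomial
    ; _≈_ = λ f g → proj₁ f S.≈ proj₁ g
    ; _+_ = addᵖ
    ; _*_ = mulᵖ
    ; -_  = negᵖ
    ; 0#  = zeroˢ , 0 , λ _ _ → refl
    ; 1#  = const 1#
    ; isCommutativeRing = record
      { isRing = record
        { +-isAbelianGroup = record
          { isGroup = record
            { isMonoid = record
              { isSemigroup = record
                { isMagma = record
                  { isEquivalence = record
                    { refl  = λ {f} → S.refl {proj₁ f}
                    ; sym   = λ {f} {g} → S.sym {proj₁ f} {proj₁ g}
                    ; trans = λ {f} {g} {h} → S.trans {proj₁ f} {proj₁ g} {proj₁ h}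
                    }
                  ; ∙-cong = λ {f} {f′} {g} {g′} → S.+-cong {proj₁ f} {proj₁ f′} {proj₁ g} {proj₁ g′}
                  }
                ; assoc = λ f g h → S.+-assoc (proj₁ f) (proj₁ g) (proj₁ h)
                }
              ; identity = (λ f → S.+-identityˡ (proj₁ f)) , (λ f → S.+-identityʳ (proj₁ f))
              }
            ; inverse = (λ f → S.-‿inverseˡ (proj₁ f)) , (λ f → S.-‿inverseʳ (proj₁ f))
            ; ⁻¹-cong = λ {f} {g} → S.-‿cong {proj₁ f} {proj₁ g}
            }
          ; comm = λ f g → S.+-comm (proj₁ f) (proj₁ g)
          }
        ; *-cong     = λ {f} {f′} {g} {g′} → S.*-cong {proj₁ f} {proj₁ f′} {proj₁ g} {proj₁ g′}
        ; *-assoc    = λ f g h → S.*-assoc (proj₁ f) (proj₁ g) (proj₁ h)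
        ; *-identity = (λ f → S.*-identityˡ (proj₁ f)) , (λ f → S.*-identityʳ (proj₁ f))
        ; distrib    = (λ f g h → S.distribˡ (proj₁ f) (proj₁ g) (proj₁ h))
                     , (λ f g h → S.distribʳ (proj₁ f) (proj₁ g) (proj₁ h))
        }
      ; *-comm = λ f g → S.*-comm (proj₁ f) (proj₁ g)
      }
    }

------------------------------------------------------------------------
-- Lattice paths

-- U = (0,1) and D = (1,0)
data Step : Set where
  U D : Step

Path : Set
Path = List Step

ups : Path → ℕ
ups []      = 0
ups (U ∷ μ) = suc (ups μ)
ups (D ∷ μ) = ups μ

downs : Path → ℕ
downs []      = 0
downs (U ∷ μ) = downs μ
downs (D ∷ μ) = suc (downs μ)

-- The vertices of μ are the points (downs ν , ups ν) for ν an initial segment of μ.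
record IsDyck (n k : ℕ) (μ : Path) : Set where
  constructor isDyck
  field
    endˣ       : downs μ ≡ k ℕ.* n
    endʸ       : ups μ ≡ n
    neverBelow : All (λ ν → downs ν ℕ.≤ k ℕ.* ups ν) (inits μ)

isDyck? : ∀ n k μ → Dec (IsDyck n k μ)
isDyck? n k μ =
  map′ (λ (x , y , b) → isDyck x y b) (λ (isDyck x y b) → x , y , b)
    (downs μ ℕ.≟ k ℕ.* n ×-dec ups μ ℕ.≟ n ×-dec
     all? (λ ν → downs ν ℕ.≤? k ℕ.* ups ν) (inits μ))

-- All paths with the given number of steps, each listed once
words : ℕ → List Path
words zero    = [] ∷ []
words (suc l) = map (U ∷_) (words l) ++ map (D ∷_) (words l)

-- The set Dyck(n;k), listed without repetition
Dyck : ℕ → ℕ → List Path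
Dyck n k = filter (isDyck? n k) (words (k ℕ.* n ℕ.+ n))

μ₀ : ℕ → ℕ → Path
μ₀ n k = concat (replicate n (U ∷ replicate k D))

-- height μ i is the ordinate of μ over the column i < x < i + 1,
-- i.e. the number of up steps preceding the (i + 1)-st down step.
height : Path → ℕ → ℕ
height []      i       = 0
height (U ∷ μ) i       = suc (height μ i)
height (D ∷ μ) zero    = 0
height (D ∷ μ) (suc i) = height μ i

-- |Y(μ₀/μ)|; a unit box is given by its lower left corner (i , j).
area : ℕ → ℕ → Path → ℕ
area n k μ =
  length (filter (λ (i , j) → height (μ₀ n k) i ℕ.≤? j ×-dec j ℕ.<? height μ i)
                 (cartesianProduct (upTo (k ℕ.* n)) (upTo n)))

-- valleySizesFrom p μ lists the sizes of the valleys of Dᵖ μ whose U lies in μ,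
-- provided that p is the length of the whole run of down steps preceding μ.
valleySizesFrom : ℕ → Path → List ℕ
valleySizesFrom p       []      = []
valleySizesFrom p       (D ∷ μ) = valleySizesFrom (suc p) μ
valleySizesFrom zero    (U ∷ μ) = valleySizesFrom zero μ
valleySizesFrom (suc p) (U ∷ μ) = suc p ∷ valleySizesFrom zero μ

valleySizes : Path → List ℕ
valleySizes = valleySizesFrom 0

Valᴵᴵ : ℕ → Path → ℕ
Valᴵᴵ k μ = length (filter (λ p → 0 ℕ.<? p ×-dec p ℕ.≤? k ℕ.∸ 1) (valleySizes μ))

------------------------------------------------------------------------
-- Finite sums and products, weights, substitution

module BigOps {c ℓ} (R : CommutativeRing c ℓ) where

  open CommutativeRing R hiding (ring)

  ∑ : {A : Set} → List A → (A → Carrier) → Carrier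
  ∑ xs f = foldr _+_ 0# (map f xs)

  -- F 0 * … * F (n - 1)
  ∏< : ℕ → (ℕ → Carrier) → Carrier
  ∏< n F = foldr _*_ 1# (applyUpTo F n)

module Weights {c ℓ} (R : CommutativeRing c ℓ) (m s u : CommutativeRing.Carrier R) where

  open CommutativeRing R hiding (ring)
  open Exp semiring using (_^_)

  m′ u′ : Carrier
  m′ = m - 1#
  u′ = u - 1#

  -- Valᴵᴵ k μ ≤ n for every μ in Dyck(n;k), so ∸ is subtraction here.
  wtᴵᴵ : ℕ → ℕ → Path → Carrier
  wtᴵᴵ n k μ = (m′ + 1#) ^ (n ℕ.∸ Valᴵᴵ k μ)
             * (u′ + 1#) ^ (n ℕ.∸ Valᴵᴵ k μ)
             * (m′ * u′ + u′ + 1#) ^ Valᴵᴵ k μ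

  -- For a series a = Σₙ aₙ rⁿ, the series a [r· t ] = Σₙ aₙ (r t)ⁿ.
  infix 9 _[r·_]
  _[r·_] : Series.Seq R → Carrier → Series.Seq R
  (a [r· t ]) n = t ^ n * a n

------------------------------------------------------------------------
-- The coefficient ring ℤ[m,s,u] = ℤ[m][s][u] and the ring ℤ[m,s,u][[r]]

ℤ[m] ℤ[m,s] ℤ[m,s,u] ℤ[m,s,u]⟦r⟧ : CommutativeRing 0ℓ 0ℓ
ℤ[m]        = Poly.ring ℤₚ.+-*-commutativeRing
ℤ[m,s]      = Poly.ring ℤ[m]
ℤ[m,s,u]    = Poly.ring ℤ[m,s]
ℤ[m,s,u]⟦r⟧ = Series.ring ℤ[m,s,u]

mᶜ sᶜ uᶜ : CommutativeRing.Carrier ℤ[m,s,u]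
mᶜ = Poly.const ℤ[m,s] (Poly.const ℤ[m] (Poly.var ℤₚ.+-*-commutativeRing))
sᶜ = Poly.const ℤ[m,s] (Poly.var ℤ[m])
uᶜ = Poly.var ℤ[m,s]

m s u r : CommutativeRing.Carrier ℤ[m,s,u]⟦r⟧
m = Series.const ℤ[m,s,u] mᶜ
s = Series.const ℤ[m,s,u] sᶜ
u = Series.const ℤ[m,s,u] uᶜ
r = Series.var ℤ[m,s,u]

open Weights ℤ[m,s,u] mᶜ sᶜ uᶜ public using (wtᴵᴵ; _[r·_])
open BigOps ℤ[m,s,u]⟦r⟧ public using (∏<)

-- Operations on coefficients; the unqualified ones act on power series.
module Coeff where
  open CommutativeRing ℤ[m,s,u] public using (_*_; -_)
  open Exp (CommutativeRing.semiring ℤ[m,s,u]) public using (_^_)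
  open BigOps ℤ[m,s,u] public using (∑)

open CommutativeRing ℤ[m,s,u]⟦r⟧ public
  using (_+_; _*_; _-_; 1#; _≈_)
  renaming (Carrier to PowerSeries)

f : PowerSeries → PowerSeries
f x = 1# + x * (m - 1#)

{-# OPTIONS --safe #-}
module Submission where

-- Read a Dyck path step by step, recording its elevation e above the line y = x/k, scaled by k, and the
-- length p of the current run of down steps. The area is the sum of the elevations at the up steps, so
-- the area and the weight become products over the up steps: with w = − s m u and
-- w′ = − s (m′ u′ + u′ + 1), the up step contributes w′ sᵉ if 1 ≤ p ≤ k − 1 and w sᵉ otherwise. The
-- generating functions F(e,p) of the possible completions of a path therefore satisfy
--   F(e,p) = [e = 0] + [e > 0] F(e−1,p+1) + r sᵉ (w or w′) F(e+k,0),
-- which determines them. With Pₑ = ∏ ξ(r sʲ) over j < e and d = w − w′ = − s m′, the solution is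
--   w F(e,p)   = w′ Pₑ₊₁ + d Pₑ₊₁₋₍ₖ₋ₚ₎     for 1 ≤ p ≤ k ≤ e + p,
--   w F(e,p)   = w Pₑ₊₁                    for p ≥ k,
--   w F(k+e,0) = w Pₖ₊ₑ₊₁ + d (Pₑ₊₁ − Pₖ₊ₑ),
-- because the functional equation at r sᵉ, multiplied by Pₑ, says that r sᵉ times the last right-hand
-- side is Pₑ₊₁ − Pₑ. Hence F(0,0) = 1 + r w F(k,0) = ξ.

open import Data.Nat using (ℕ; suc; _≤_)
open import Data.Nat using (zero; pred; z≤n; s≤s; _<_)
import Data.Nat as ℕ
import Data.Nat.Properties as ℕₚ
import Data.Nat.Tactic.RingSolver as ℕ-Solver
open import Data.Nat.ListAction using (sum)
open import Data.Bool.Base using (true; false; if_then_else_)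
open import Data.List.Base
  using (List; []; _∷_; _++_; map; filter; length; replicate; applyUpTo; upTo; inits; cartesianProduct)
open import Data.List.Properties using (filter-++; length-++; applyUpTo-∷ʳ; map-upTo)
open import Data.List.Relation.Unary.All as All using (All; []; _∷_)
import Data.List.Relation.Unary.All.Properties as Allₚ
open import Data.Product.Base using (_×_; _,_)
open import Function using (_∘_; id)
open import Relation.Nullary using (¬_; Dec; yes; no; does; contradiction)
open import Relation.Nullary.Decidable using (_×-dec_; dec-true; dec-false)
open import Relation.Unary using (Decidable)
open import Relation.Binary.PropositionalEquality as ≡ using (_≡_)
import Relation.Binary.Reasoning.Setoid as SetoidReasoning
open import Algebra.Bundles using (CommutativeRing)
import Algebra.Properties.Semiring.Exp as Exp
import Algebra.Properties.Ring as RingProperties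
import Algebra.Properties.CommutativeSemiring.Exp as CExp
import Algebra.Solver.Ring.NaturalCoefficients.Default as SemiringSolver
open import Defs using
  ( Path; U; D; ups; downs; IsDyck; isDyck; isDyck?; μ₀; height; area; Dyck; words; Valᴵᴵ; valleySizesFrom
  ; module Series; module BigOps; module Weights )

-- Dyck paths as walks in the elevation.

module LatticePaths where

  open ≡ using (refl; sym; trans; cong; cong₂; subst; module ≡-Reasoning)
  open ℕ-Solver using (solve-∀)

  -- A path is read from its current elevation e = k·(ups so far) − (downs so far).
  data Returns (k : ℕ) : ℕ → Path → Set where
    done : Returns k 0 []
    up   : ∀ {e μ} → Returns k (k ℕ.+ e) μ → Returns k e (U ∷ μ)
    down : ∀ {e μ} → Returns k e μ → Returns k (suc e) (D ∷ μ)

  module _ {k : ℕ} where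

    private
      regroup : ∀ k a x → k ℕ.+ a ℕ.+ k ℕ.* x ≡ a ℕ.+ k ℕ.* suc x
      regroup = solve-∀

    Returns-downs : ∀ {e μ} → Returns k e μ → downs μ ≡ e ℕ.+ k ℕ.* ups μ
    Returns-downs done     = sym (ℕₚ.*-zeroʳ k)
    Returns-downs (up {e} {μ} p) = trans (Returns-downs p) (regroup k e (ups μ))
    Returns-downs (down p) = cong suc (Returns-downs p)

    Returns-prefix : ∀ {e μ} → Returns k e μ → All (λ ν → downs ν ℕ.≤ e ℕ.+ k ℕ.* ups ν) (inits μ)
    Returns-prefix done = z≤n ∷ []
    Returns-prefix (up {e} p) with Returns-prefix p
    ... | _ ∷ ps = z≤n ∷ (z≤n ∷ Allₚ.map⁺ (All.map (λ {ν} q → ℕₚ.≤-trans q (ℕₚ.≤-reflexive (regroup k e (ups ν)))) ps))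
    Returns-prefix (down p) with Returns-prefix p
    ... | q ∷ ps = z≤n ∷ (s≤s q ∷ Allₚ.map⁺ (All.map s≤s ps))

    prefix-Returns : ∀ {e} μ → downs μ ≡ e ℕ.+ k ℕ.* ups μ →
                     All (λ ν → downs ν ℕ.≤ e ℕ.+ k ℕ.* ups ν) (inits μ) → Returns k e μ
    prefix-Returns {zero}  []      _ _ = done
    prefix-Returns {suc e} []      () _
    prefix-Returns {e}     (U ∷ μ) p (_ ∷ _ ∷ qs) =
      up (prefix-Returns μ (trans p (sym (regroup k e (ups μ))))
            (z≤n ∷ All.map (λ {ν} q → ℕₚ.≤-trans q (ℕₚ.≤-reflexive (sym (regroup k e (ups ν))))) (Allₚ.map⁻ qs)))
    -- `q` is the bound at the one-step prefix `D`, namely 1 ≤ k · 0.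
    prefix-Returns {zero}  (D ∷ μ) p (_ ∷ q ∷ _) =
      contradiction (subst (1 ≤_) (ℕₚ.*-zeroʳ k) q) λ ()
    prefix-Returns {suc e} (D ∷ μ) p (_ ∷ _ ∷ qs) =
      down (prefix-Returns μ (ℕₚ.suc-injective p) (z≤n ∷ All.map ℕ.s≤s⁻¹ (Allₚ.map⁻ qs)))

    -- Each up step is paid back by k down steps, and e more reach the line. The length therefore
    -- determines the number of up steps, which is how `Returns⇒IsDyck` recovers n.
    Returns-length : ∀ {e μ} → Returns k e μ → length μ ≡ e ℕ.+ suc k ℕ.* ups μ
    Returns-length done = sym (ℕₚ.*-zeroʳ k)
    Returns-length (up {e} {μ} p) = trans (cong suc (Returns-length p)) (regroup′ k e (ups μ))
      where
      regroup′ : ∀ k e x → suc (k ℕ.+ e ℕ.+ suc k ℕ.* x) ≡ e ℕ.+ suc k ℕ.* suc x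
      regroup′ = solve-∀
    Returns-length (down p) = cong suc (Returns-length p)

    IsDyck⇒Returns : ∀ {n μ} → IsDyck n k μ → Returns k 0 μ
    IsDyck⇒Returns {n} {μ} (isDyck x y b) = prefix-Returns μ (trans x (cong (k ℕ.*_) (sym y))) b

    Returns⇒IsDyck : ∀ {n μ} → length μ ≡ k ℕ.* n ℕ.+ n → Returns k 0 μ → IsDyck n k μ
    Returns⇒IsDyck {n} {μ} len p =
      isDyck (trans (Returns-downs p) (cong (k ℕ.*_) ups≡n)) ups≡n (Returns-prefix p)
      where
      ups≡n : ups μ ≡ n
      ups≡n = ℕₚ.*-cancelˡ-≡ (ups μ) n (suc k)
        (trans (sym (Returns-length p)) (trans len (ℕₚ.+-comm (k ℕ.* n) n)))

  -- On a path with `Returns k e`, `pred` is never applied to 0.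
  elevationSum : ℕ → ℕ → Path → ℕ
  elevationSum k e []      = 0
  elevationSum k e (U ∷ μ) = e ℕ.+ elevationSum k (k ℕ.+ e) μ
  elevationSum k e (D ∷ μ) = elevationSum k (pred e) μ

  heightSum : Path → ℕ
  heightSum μ = sum (applyUpTo (height μ) (downs μ))

  triangle : ℕ → ℕ
  triangle zero    = 0
  triangle (suc n) = suc n ℕ.+ triangle n

  sum-applyUpTo-suc : ∀ h n → sum (applyUpTo (suc ∘ h) n) ≡ n ℕ.+ sum (applyUpTo h n)
  sum-applyUpTo-suc h zero    = refl
  sum-applyUpTo-suc h (suc n) = cong suc (begin
    h 0 ℕ.+ sum (applyUpTo (suc ∘ h ∘ suc) n)     ≡⟨ cong (h 0 ℕ.+_) (sum-applyUpTo-suc (h ∘ suc) n) ⟩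
    h 0 ℕ.+ (n ℕ.+ sum (applyUpTo (h ∘ suc) n))   ≡⟨ swap (h 0) n _ ⟩
    n ℕ.+ (h 0 ℕ.+ sum (applyUpTo (h ∘ suc) n))   ∎)
    where
    open ≡-Reasoning
    swap : ∀ a b c → a ℕ.+ (b ℕ.+ c) ≡ b ℕ.+ (a ℕ.+ c)
    swap = solve-∀

  -- heightSum μ counts the pairs of a U before a D. For e = 0 the elevation sum is k·(0 + … + (ups μ − 1))
  -- minus the number of pairs of a D before a U, and the two pair counts add up to ups μ · downs μ.
  heightSum≡elevationSum+ : ∀ {k e μ} → Returns k e μ →
                            heightSum μ ≡ elevationSum k e μ ℕ.+ k ℕ.* triangle (ups μ)
  heightSum≡elevationSum+ {k} done = sym (ℕₚ.*-zeroʳ k)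
  heightSum≡elevationSum+ {k} (up {e} {μ} p) = begin
    sum (applyUpTo (suc ∘ height μ) (downs μ)) ≡⟨ sum-applyUpTo-suc (height μ) (downs μ) ⟩
    downs μ ℕ.+ heightSum μ
      ≡⟨ cong₂ ℕ._+_ (Returns-downs p) (heightSum≡elevationSum+ p) ⟩
    k ℕ.+ e ℕ.+ k ℕ.* ups μ ℕ.+ (elevationSum k (k ℕ.+ e) μ ℕ.+ k ℕ.* triangle (ups μ))
      ≡⟨ regroup k e (ups μ) (elevationSum k (k ℕ.+ e) μ) (triangle (ups μ)) ⟩
    e ℕ.+ elevationSum k (k ℕ.+ e) μ ℕ.+ k ℕ.* (suc (ups μ) ℕ.+ triangle (ups μ)) ∎
    where
    open ≡-Reasoning
    regroup : ∀ k e x y z → k ℕ.+ e ℕ.+ k ℕ.* x ℕ.+ (y ℕ.+ k ℕ.* z) ≡ e ℕ.+ y ℕ.+ k ℕ.* (suc x ℕ.+ z)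
    regroup = solve-∀
  heightSum≡elevationSum+ (down p) = heightSum≡elevationSum+ p

  -- The (i + 1)-st down step ends at a vertex with i + 1 down steps and `height μ i` up steps
  -- before it, and that vertex is not below the line.
  height-lower : ∀ {k e μ} → Returns k e μ → ∀ {i} → i < downs μ → i < e ℕ.+ k ℕ.* height μ i
  height-lower {k} (up {e} {μ} p) {i} i< =
    ℕₚ.≤-trans (height-lower p i<) (ℕₚ.≤-reflexive (regroup k e (height μ i)))
    where
    regroup : ∀ k a x → k ℕ.+ a ℕ.+ k ℕ.* x ≡ a ℕ.+ k ℕ.* suc x
    regroup = solve-∀
  height-lower (down p) {zero}  _        = s≤s z≤n
  height-lower (down p) {suc i} (s≤s i<) = s≤s (height-lower p i<)

  height≤ups : ∀ μ i → height μ i ≤ ups μ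
  height≤ups []      i       = z≤n
  height≤ups (U ∷ μ) i       = s≤s (height≤ups μ i)
  height≤ups (D ∷ μ) zero    = z≤n
  height≤ups (D ∷ μ) (suc i) = height≤ups μ i

  module _ {k : ℕ} where

    -- The down steps in front let this induction and the next ones go through a block `U D^k` step
    -- by step; q is also the starting elevation.
    μ₀-returns : ∀ n q → Returns k q (replicate q D ++ μ₀ n k)
    μ₀-returns n       (suc q) = down (μ₀-returns n q)
    μ₀-returns zero    zero    = done
    μ₀-returns (suc n) zero    = up (subst (λ e → Returns k e (replicate k D ++ μ₀ n k))
                                           (sym (ℕₚ.+-identityʳ k)) (μ₀-returns n k))

    μ₀-elevationSum : ∀ n q → elevationSum k q (replicate q D ++ μ₀ n k) ≡ 0
    μ₀-elevationSum n       (suc q) = μ₀-elevationSum n q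
    μ₀-elevationSum zero    zero    = refl
    μ₀-elevationSum (suc n) zero    =
      trans (cong (λ e → elevationSum k e (replicate k D ++ μ₀ n k)) (ℕₚ.+-identityʳ k)) (μ₀-elevationSum n k)

    μ₀-ups : ∀ n q → ups (replicate q D ++ μ₀ n k) ≡ n
    μ₀-ups n       (suc q) = μ₀-ups n q
    μ₀-ups zero    zero    = refl
    μ₀-ups (suc n) zero    = cong suc (μ₀-ups n k)

    -- Take q = 0 and let h be the height over column i. The h-th up step of the lowest path starts
    -- on the line at abscissa k · (h - 1), and it precedes the column.
    μ₀-height : ∀ n q i → q ≤ k → k ℕ.* height (replicate q D ++ μ₀ n k) i ℕ.+ q ≤ i ℕ.+ k
    μ₀-height n       (suc q) zero    q≤k = subst (_≤ k) (cong (ℕ._+ suc q) (sym (ℕₚ.*-zeroʳ k))) q≤k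
    μ₀-height n       (suc q) (suc i) q≤k =
      subst (_≤ suc i ℕ.+ k) (sym (ℕₚ.+-suc _ q)) (s≤s (μ₀-height n q i (ℕₚ.≤-trans (ℕₚ.n≤1+n q) q≤k)))
    μ₀-height zero    zero    i       q≤k =
      subst (_≤ i ℕ.+ k) (sym (trans (ℕₚ.+-identityʳ _) (ℕₚ.*-zeroʳ k))) z≤n
    μ₀-height (suc n) zero    i       q≤k =
      ℕₚ.≤-trans (ℕₚ.≤-reflexive (regroup k (height (replicate k D ++ μ₀ n k) i))) (μ₀-height n k i ℕₚ.≤-refl)
      where
      regroup : ∀ k x → k ℕ.* suc x ℕ.+ 0 ≡ k ℕ.* x ℕ.+ k
      regroup = solve-∀

    height-μ₀≤ : ∀ n {μ} → Returns k 0 μ → ∀ {i} → i < downs μ → height (μ₀ n k) i ≤ height μ i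
    height-μ₀≤ n {μ} p {i} i< = ℕ.s≤s⁻¹ (ℕₚ.*-cancelˡ-< k _ _ (begin-strict
      k ℕ.* height (μ₀ n k) i       ≡⟨ ℕₚ.+-identityʳ _ ⟨
      k ℕ.* height (μ₀ n k) i ℕ.+ 0 ≤⟨ μ₀-height n 0 i z≤n ⟩
      i ℕ.+ k                       <⟨ ℕₚ.+-monoˡ-< k (height-lower p i<) ⟩
      k ℕ.* height μ i ℕ.+ k        ≡⟨ ℕₚ.+-comm _ k ⟩
      k ℕ.+ k ℕ.* height μ i        ≡⟨ ℕₚ.*-suc k (height μ i) ⟨
      k ℕ.* suc (height μ i)        ∎))
      where open ℕₚ.≤-Reasoning

  -- Counting the boxes column by column.

  length-filter-∷ʳ-yes : ∀ {A : Set} {P : A → Set} (P? : Decidable P) xs {x} → P x →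
                         length (filter P? (xs ++ x ∷ [])) ≡ suc (length (filter P? xs))
  length-filter-∷ʳ-yes P? []       {x} px rewrite dec-true (P? x) px = refl
  length-filter-∷ʳ-yes P? (y ∷ xs) px with does (P? y)
  ... | true  = cong suc (length-filter-∷ʳ-yes P? xs px)
  ... | false = length-filter-∷ʳ-yes P? xs px

  length-filter-∷ʳ-no : ∀ {A : Set} {P : A → Set} (P? : Decidable P) xs {x} → ¬ P x →
                        length (filter P? (xs ++ x ∷ [])) ≡ length (filter P? xs)
  length-filter-∷ʳ-no P? []       {x} ¬px rewrite dec-false (P? x) ¬px = refl
  length-filter-∷ʳ-no P? (y ∷ xs) ¬px with does (P? y)
  ... | true  = cong suc (length-filter-∷ʳ-no P? xs ¬px)
  ... | false = length-filter-∷ʳ-no P? xs ¬px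

  -- Cutting both ends at n makes the claim inductive in n without b ≤ n; the index n is appended at
  -- the right end of the range.
  interval-count-⊓ : ∀ {a b} → a ≤ b → ∀ n →
    length (filter (λ j → a ℕ.≤? j ×-dec j ℕ.<? b) (upTo n)) ℕ.+ a ℕ.⊓ n ≡ b ℕ.⊓ n
  interval-count-⊓ {a} {b} a≤b zero rewrite ℕₚ.⊓-zeroʳ a | ℕₚ.⊓-zeroʳ b = refl
  interval-count-⊓ {a} {b} a≤b (suc n) = begin
    count (upTo (suc n)) ℕ.+ a ℕ.⊓ suc n
      ≡⟨ cong (λ xs → count xs ℕ.+ a ℕ.⊓ suc n) (applyUpTo-∷ʳ id n) ⟨
    count (upTo n ++ n ∷ []) ℕ.+ a ℕ.⊓ suc n
      ≡⟨ step (a ℕ.≤? n) (n ℕ.<? b) ⟩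
    b ℕ.⊓ suc n ∎
    where
    open ≡-Reasoning
    inside? : Decidable (λ j → a ≤ j × j < b)
    inside? j = a ℕ.≤? j ×-dec j ℕ.<? b
    count = λ xs → length (filter inside? xs)
    ih = interval-count-⊓ a≤b n
    step : Dec (a ≤ n) → Dec (n < b) → count (upTo n ++ n ∷ []) ℕ.+ a ℕ.⊓ suc n ≡ b ℕ.⊓ suc n
    step (yes a≤n) (yes n<b) = begin
      count (upTo n ++ n ∷ []) ℕ.+ a ℕ.⊓ suc n
        ≡⟨ cong₂ ℕ._+_ (length-filter-∷ʳ-yes inside? (upTo n) (a≤n , n<b)) (ℕₚ.m≤n⇒m⊓n≡m (ℕₚ.m≤n⇒m≤1+n a≤n)) ⟩
      suc (count (upTo n)) ℕ.+ a           ≡⟨ cong (λ x → suc (count (upTo n) ℕ.+ x)) (ℕₚ.m≤n⇒m⊓n≡m a≤n) ⟨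
      suc (count (upTo n) ℕ.+ a ℕ.⊓ n)     ≡⟨ cong suc ih ⟩
      suc (b ℕ.⊓ n)                        ≡⟨ cong suc (ℕₚ.m≥n⇒m⊓n≡n (ℕₚ.<⇒≤ n<b)) ⟩
      suc n                                ≡⟨ ℕₚ.m≥n⇒m⊓n≡n n<b ⟨
      b ℕ.⊓ suc n                          ∎
    step (no a≰n) _ = begin
      count (upTo n ++ n ∷ []) ℕ.+ a ℕ.⊓ suc n
        ≡⟨ cong₂ ℕ._+_ (length-filter-∷ʳ-no inside? (upTo n) (λ (p , _) → a≰n p)) (ℕₚ.m≥n⇒m⊓n≡n n<a) ⟩
      count (upTo n) ℕ.+ suc n             ≡⟨ ℕₚ.+-suc (count (upTo n)) n ⟩
      suc (count (upTo n) ℕ.+ n)           ≡⟨ cong (λ x → suc (count (upTo n) ℕ.+ x)) (ℕₚ.m≥n⇒m⊓n≡n (ℕₚ.<⇒≤ n<a)) ⟨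
      suc (count (upTo n) ℕ.+ a ℕ.⊓ n)     ≡⟨ cong suc ih ⟩
      suc (b ℕ.⊓ n)                        ≡⟨ cong suc (ℕₚ.m≥n⇒m⊓n≡n (ℕₚ.<⇒≤ (ℕₚ.<-≤-trans n<a a≤b))) ⟩
      suc n                                ≡⟨ ℕₚ.m≥n⇒m⊓n≡n (ℕₚ.<-≤-trans n<a a≤b) ⟨
      b ℕ.⊓ suc n                          ∎
      where n<a = ℕₚ.≰⇒> a≰n
    step (yes a≤n) (no n≮b) = begin
      count (upTo n ++ n ∷ []) ℕ.+ a ℕ.⊓ suc n
        ≡⟨ cong₂ ℕ._+_ (length-filter-∷ʳ-no inside? (upTo n) (λ (_ , q) → n≮b q)) (ℕₚ.m≤n⇒m⊓n≡m (ℕₚ.m≤n⇒m≤1+n a≤n)) ⟩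
      count (upTo n) ℕ.+ a                 ≡⟨ cong (count (upTo n) ℕ.+_) (ℕₚ.m≤n⇒m⊓n≡m a≤n) ⟨
      count (upTo n) ℕ.+ a ℕ.⊓ n           ≡⟨ ih ⟩
      b ℕ.⊓ n                              ≡⟨ ℕₚ.m≤n⇒m⊓n≡m b≤n ⟩
      b                                    ≡⟨ ℕₚ.m≤n⇒m⊓n≡m (ℕₚ.m≤n⇒m≤1+n b≤n) ⟨
      b ℕ.⊓ suc n                          ∎
      where b≤n = ℕₚ.≮⇒≥ n≮b

  interval-count : ∀ {a b n} → a ≤ b → b ≤ n →
    length (filter (λ j → a ℕ.≤? j ×-dec j ℕ.<? b) (upTo n)) ℕ.+ a ≡ b
  interval-count {a} {b} {n} a≤b b≤n = begin
    c ℕ.+ a       ≡⟨ cong (c ℕ.+_) (ℕₚ.m≤n⇒m⊓n≡m (ℕₚ.≤-trans a≤b b≤n)) ⟨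
    c ℕ.+ a ℕ.⊓ n ≡⟨ interval-count-⊓ a≤b n ⟩
    b ℕ.⊓ n       ≡⟨ ℕₚ.m≤n⇒m⊓n≡m b≤n ⟩
    b             ∎
    where
    open ≡-Reasoning
    c = length (filter (λ j → a ℕ.≤? j ×-dec j ℕ.<? b) (upTo n))

  length-filter-map : ∀ {A B : Set} {P : B → Set} (P? : Decidable P) (g : A → B) xs →
                      length (filter P? (map g xs)) ≡ length (filter (λ x → P? (g x)) xs)
  length-filter-map P? g []       = refl
  length-filter-map P? g (x ∷ xs) with does (P? (g x))
  ... | true  = cong suc (length-filter-map P? g xs)
  ... | false = length-filter-map P? g xs

  length-filter-cartesianProduct : ∀ {A B : Set} {P : A × B → Set} (P? : Decidable P) xs ys →
    length (filter P? (cartesianProduct xs ys)) ≡ sum (map (λ x → length (filter (λ y → P? (x , y)) ys)) xs)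
  length-filter-cartesianProduct P? []       ys = refl
  length-filter-cartesianProduct P? (x ∷ xs) ys = begin
    length (filter P? (map (x ,_) ys ++ cartesianProduct xs ys))
      ≡⟨ cong length (filter-++ P? (map (x ,_) ys) _) ⟩
    length (filter P? (map (x ,_) ys) ++ filter P? (cartesianProduct xs ys))
      ≡⟨ length-++ (filter P? (map (x ,_) ys)) ⟩
    length (filter P? (map (x ,_) ys)) ℕ.+ length (filter P? (cartesianProduct xs ys))
      ≡⟨ cong₂ ℕ._+_ (length-filter-map P? (x ,_) ys) (length-filter-cartesianProduct P? xs ys) ⟩
    length (filter (λ y → P? (x , y)) ys) ℕ.+ _ ∎
    where open ≡-Reasoning

  sum-applyUpTo-+ : ∀ {f g h : ℕ → ℕ} n → (∀ {i} → i < n → f i ℕ.+ g i ≡ h i) →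
                    sum (applyUpTo f n) ℕ.+ sum (applyUpTo g n) ≡ sum (applyUpTo h n)
  sum-applyUpTo-+ zero    p = refl
  sum-applyUpTo-+ {f} {g} (suc n) p =
    trans (regroup (f 0) _ (g 0) _) (cong₂ ℕ._+_ (p (s≤s z≤n)) (sum-applyUpTo-+ n (λ i<n → p (s≤s i<n))))
    where
    regroup : ∀ a b c d → a ℕ.+ b ℕ.+ (c ℕ.+ d) ≡ a ℕ.+ c ℕ.+ (b ℕ.+ d)
    regroup = solve-∀

  -- In each column the boxes fill the gap between the two heights, so the area is a difference of
  -- height sums. Each height sum exceeds its elevation sum by k · `triangle n`, and every up step
  -- of `μ₀` starts at elevation 0.
  area≡elevationSum : ∀ {n k μ} → IsDyck n k μ → area n k μ ≡ elevationSum k 0 μ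
  area≡elevationSum {n} {k} {μ} dyck@(isDyck x y _) = ℕₚ.+-cancelʳ-≡ (k ℕ.* triangle n) _ _ (begin
    area n k μ ℕ.+ k ℕ.* triangle n
      ≡⟨ cong₂ ℕ._+_
           (trans (length-filter-cartesianProduct (λ (i , j) → height (μ₀ n k) i ℕ.≤? j ×-dec j ℕ.<? height μ i)
                     (upTo (k ℕ.* n)) (upTo n))
                  (cong sum (map-upTo boxes (k ℕ.* n))))
           μ₀-heightSum ⟩
    sum (applyUpTo boxes (k ℕ.* n)) ℕ.+ sum (applyUpTo (height (μ₀ n k)) (k ℕ.* n))
      ≡⟨ sum-applyUpTo-+ (k ℕ.* n) (λ {i} i<kn →
           interval-count (height-μ₀≤ n returns (subst (i <_) (sym x) i<kn)) (subst (height μ i ≤_) y (height≤ups μ i))) ⟩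
    sum (applyUpTo (height μ) (k ℕ.* n))
      ≡⟨ cong (λ l → sum (applyUpTo (height μ) l)) x ⟨
    heightSum μ
      ≡⟨ heightSum≡elevationSum+ returns ⟩
    elevationSum k 0 μ ℕ.+ k ℕ.* triangle (ups μ)
      ≡⟨ cong (λ l → elevationSum k 0 μ ℕ.+ k ℕ.* triangle l) y ⟩
    elevationSum k 0 μ ℕ.+ k ℕ.* triangle n ∎)
    where
    open ≡-Reasoning
    returns = IsDyck⇒Returns dyck
    boxes = λ i → length (filter (λ j → height (μ₀ n k) i ℕ.≤? j ×-dec j ℕ.<? height μ i) (upTo n))
    μ₀-heightSum : k ℕ.* triangle n ≡ sum (applyUpTo (height (μ₀ n k)) (k ℕ.* n))
    μ₀-heightSum = begin
      k ℕ.* triangle n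
        ≡⟨ cong₂ (λ a l → a ℕ.+ k ℕ.* triangle l) (μ₀-elevationSum n 0) (μ₀-ups n 0) ⟨
      elevationSum k 0 (μ₀ n k) ℕ.+ k ℕ.* triangle (ups (μ₀ n k))
        ≡⟨ heightSum≡elevationSum+ (μ₀-returns n 0) ⟨
      heightSum (μ₀ n k)
        ≡⟨ cong (λ l → sum (applyUpTo (height (μ₀ n k)) l))
             (trans (Returns-downs (μ₀-returns n 0)) (cong (k ℕ.*_) (μ₀-ups n 0))) ⟩
      sum (applyUpTo (height (μ₀ n k)) (k ℕ.* n)) ∎

open LatticePaths

-- Sums over all words.

words-length : ∀ l → All (λ ν → length ν ≡ l) (words l)
words-length zero    = ≡.refl ∷ []
words-length (suc l) = Allₚ.++⁺ (Allₚ.map⁺ (All.map (≡.cong suc) (words-length l)))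
                                (Allₚ.map⁺ (All.map (≡.cong suc) (words-length l)))

module Sums {c ℓ} (R : CommutativeRing c ℓ) where

  open CommutativeRing R hiding (zero; ring)
  open BigOps R using (∑)
  open SetoidReasoning setoid

  ∑-zero : ∀ {A : Set} {g : A → Carrier} {xs} → All (λ x → g x ≈ 0#) xs → ∑ xs g ≈ 0#
  ∑-zero []       = refl
  ∑-zero (p ∷ ps) = trans (+-cong p (∑-zero ps)) (+-identityˡ 0#)

  ∑-scale : ∀ {A : Set} a (g : A → Carrier) xs → ∑ xs (λ x → a * g x) ≈ a * ∑ xs g
  ∑-scale a g []       = sym (zeroʳ a)
  ∑-scale a g (x ∷ xs) = trans (+-congˡ (∑-scale a g xs)) (sym (distribˡ a _ _))

  ∑-++ : ∀ {A : Set} (g : A → Carrier) xs ys → ∑ (xs ++ ys) g ≈ ∑ xs g + ∑ ys g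
  ∑-++ g []       ys = sym (+-identityˡ _)
  ∑-++ g (x ∷ xs) ys = trans (+-congˡ (∑-++ g xs ys)) (sym (+-assoc _ _ _))

  ∑-map : ∀ {A B : Set} (g : B → Carrier) (h : A → B) xs → ∑ (map h xs) g ≈ ∑ xs (g ∘ h)
  ∑-map g h []       = refl
  ∑-map g h (x ∷ xs) = +-congˡ (∑-map g h xs)

  -- Used to replace the sum over `Dyck n k` by a sum over all words, with a weight that vanishes
  -- off the Dyck paths.
  ∑-filter : ∀ {A : Set} {P : A → Set} (P? : Decidable P) {g h : A → Carrier} {xs} →
             All (λ x → (P x → g x ≈ h x) × (¬ P x → h x ≈ 0#)) xs → ∑ (filter P? xs) g ≈ ∑ xs h
  ∑-filter P? []                      = refl
  ∑-filter P? {xs = x ∷ _} ((p , q) ∷ ps) with P? x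
  ... | yes px = +-cong (p px) (∑-filter P? ps)
  ... | no ¬px = trans (∑-filter P? ps) (sym (trans (+-congʳ (q ¬px)) (+-identityˡ _)))

  ∑-words-suc : ∀ l (g : Path → Carrier) →
                ∑ (words (suc l)) g ≈ ∑ (words l) (g ∘ (U ∷_)) + ∑ (words l) (g ∘ (D ∷_))
  ∑-words-suc l g = trans (∑-++ g (map (U ∷_) (words l)) _) (+-cong (∑-map g _ (words l)) (∑-map g _ (words l)))

-- The substitution r ↦ r t and the products Pₑ.

module Dilation {c ℓ} (R : CommutativeRing c ℓ) where

  open CommutativeRing R hiding (zero; ring)
  open Series R
  open Exp semiring
  open CExp commutativeSemiring using (^-distrib-*)
  open BigOps ring using (∏<)
  -- Dilation does not depend on the last three parameters.
  open Weights R 0# 0# 0# using (_[r·_])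
  open SetoidReasoning setoid
  open SemiringSolver commutativeSemiring using (solve; _:=_; _:+_; _:*_; con)
  private module S = CommutativeRing ring

  conv-var-zero : ∀ g → conv var g 0 ≈ 0#
  conv-var-zero g = zeroˡ _

  conv-var-suc : ∀ g n → conv var g (suc n) ≈ g n
  conv-var-suc g n = begin
    0# * g (suc n) + conv (tail var) g n ≈⟨ +-cong (zeroˡ _) (conv-cong tail-var S.refl n) ⟩
    0# + conv (const 1#) g n             ≈⟨ +-identityˡ _ ⟩
    conv (const 1#) g n                  ≈⟨ conv-identityˡ g n ⟩
    g n                                  ∎
    where
    tail-var : tail var ≋ const 1#
    tail-var zero    = refl
    tail-var (suc _) = refl

  conv-const : ∀ a g n → conv (const a) g n ≈ a * g n
  conv-const a g zero    = refl
  conv-const a g (suc n) = trans (+-congˡ (conv-zeroˡ g n (λ _ → refl))) (+-identityʳ _)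

  dilate-cong : ∀ {g h t} → g ≋ h → g [r· t ] ≋ h [r· t ]
  dilate-cong p n = *-congˡ (p n)

  1^≈1 : ∀ n → 1# ^ n ≈ 1#
  1^≈1 zero    = refl
  1^≈1 (suc n) = trans (*-identityˡ _) (1^≈1 n)

  dilate-1 : ∀ g → g [r· 1# ] ≋ g
  dilate-1 g n = trans (*-congʳ (1^≈1 n)) (*-identityˡ _)

  dilate-one : ∀ t → const 1# [r· t ] ≋ const 1#
  dilate-one t zero    = *-identityˡ 1#
  dilate-one t (suc n) = zeroʳ _

  dilate-tail : ∀ g t n → t ^ suc n * g (suc n) ≈ t * (tail g [r· t ]) n
  dilate-tail g t n = *-assoc _ _ _

  dilate-conv : ∀ g h t → conv g h [r· t ] ≋ conv (g [r· t ]) (h [r· t ])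
  dilate-conv g h t zero =
    solve 2 (λ x y → con 1 :* (x :* y) := con 1 :* x :* (con 1 :* y)) refl (g 0) (h 0)
  dilate-conv g h t (suc n) = begin
    t * t ^ n * (g 0 * h (suc n) + conv (tail g) h n)
      ≈⟨ solve 5 (λ t y a b d → t :* y :* (a :* b :+ d) := con 1 :* a :* (t :* y :* b) :+ t :* (y :* d))
           refl t (t ^ n) (g 0) (h (suc n)) (conv (tail g) h n) ⟩
    t ^ 0 * g 0 * (t ^ suc n * h (suc n)) + t * (t ^ n * conv (tail g) h n)
      ≈⟨ +-congˡ (*-congˡ (dilate-conv (tail g) h t n)) ⟩
    t ^ 0 * g 0 * (t ^ suc n * h (suc n)) + t * conv (tail g [r· t ]) (h [r· t ]) n
      ≈⟨ +-congˡ (conv-scaleˡ t _ _ n) ⟨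
    t ^ 0 * g 0 * (t ^ suc n * h (suc n)) + conv (λ i → t * (tail g [r· t ]) i) (h [r· t ]) n
      ≈⟨ +-congˡ (conv-cong (dilate-tail g t) S.refl n) ⟨
    conv (g [r· t ]) (h [r· t ]) (suc n) ∎

  dilate-dilate : ∀ g t t′ → (g [r· t ]) [r· t′ ] ≋ g [r· t′ * t ]
  dilate-dilate g t t′ n = trans (sym (*-assoc _ _ _)) (*-congʳ (sym (^-distrib-* t′ t n)))

  dilate-base : ∀ g {t t′} → t ≈ t′ → g [r· t ] ≋ g [r· t′ ]
  dilate-base g p n = *-congʳ (^-congˡ n p)

  ∏<-cong : ∀ n {F G : ℕ → Seq} → (∀ i → F i ≋ G i) → ∏< n F ≋ ∏< n G
  ∏<-cong zero    p = S.refl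
  ∏<-cong (suc n) p = S.*-cong (p 0) (∏<-cong n (p ∘ suc))

  ∏<-+ : ∀ a b (F : ℕ → Seq) → ∏< (a ℕ.+ b) F ≋ conv (∏< a F) (∏< b (λ j → F (a ℕ.+ j)))
  ∏<-+ zero    b F = S.sym (S.*-identityˡ _)
  ∏<-+ (suc a) b F = S.trans (S.*-congˡ (∏<-+ a b (F ∘ suc))) (S.sym (S.*-assoc (F 0) (∏< a (F ∘ suc)) _))

  ∏<-dilate : ∀ n (F : ℕ → Seq) t → ∏< n F [r· t ] ≋ ∏< n (λ j → F j [r· t ])
  ∏<-dilate zero    F t = dilate-one t
  ∏<-dilate (suc n) F t = S.trans (dilate-conv (F 0) _ t) (S.*-congˡ (∏<-dilate n (F ∘ suc) t))

  module Products (s : Carrier) (ξ : Seq) where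

    P : ℕ → Seq
    P e = ∏< e (λ j → ξ [r· s ^ j ])

    -- The last b factors of `P (a + b)` are the factors of `P b` after r ↦ r sᵃ.
    P-+ : ∀ a b → P (a ℕ.+ b) ≋ conv (P b [r· s ^ a ]) (P a)
    P-+ a b = S.trans (∏<-+ a b _) (S.trans (S.*-congˡ (S.sym shifted)) (S.*-comm (P a) _))
      where
      shifted : P b [r· s ^ a ] ≋ ∏< b (λ j → ξ [r· s ^ (a ℕ.+ j) ])
      shifted = S.trans (∏<-dilate b _ (s ^ a))
        (∏<-cong b λ j → S.trans (dilate-dilate ξ (s ^ j) (s ^ a)) (dilate-base ξ (sym (^-homo-* s a j))))

    P-one : P 1 ≋ ξ
    P-one = S.trans (S.*-identityʳ _) (dilate-1 ξ)

    module _ (ξ₀≈1 : ξ 0 ≈ 1#) where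

      P-head : ∀ e → P e 0 ≈ 1#
      P-head zero    = refl
      P-head (suc e) = trans (P-+ 1 e 0) (trans
        (*-cong (trans (*-identityˡ _) (P-head e)) (trans (P-one 0) ξ₀≈1)) (*-identityˡ 1#))

      -- `P (suc e)` is ξ(r sᵉ) · `P e`. The constant term 1 of ξ(r sᵉ) reproduces `P e`, and the
      -- rest of ξ(r sᵉ) is r sᵉ times the dilated `tail ξ`.
      P-suc-tail : ∀ e n → P (suc e) (suc n) ≈ P e (suc n) + s ^ e * conv (tail ξ [r· s ^ e ]) (P e) n
      P-suc-tail e n = begin
        P (suc e) (suc n) ≡⟨ ≡.cong (λ i → P i (suc n)) (ℕₚ.+-comm 1 e) ⟩
        P (e ℕ.+ 1) (suc n) ≈⟨ P-+ e 1 (suc n) ⟩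
        conv (P 1 [r· s ^ e ]) (P e) (suc n) ≈⟨ conv-cong (dilate-cong P-one) S.refl (suc n) ⟩
        1# * ξ 0 * P e (suc n) + conv (tail (ξ [r· s ^ e ])) (P e) n
          ≈⟨ +-cong (trans (*-congʳ (trans (*-identityˡ _) ξ₀≈1)) (*-identityˡ _))
                    (conv-cong (dilate-tail ξ (s ^ e)) S.refl n) ⟩
        P e (suc n) + conv (λ i → s ^ e * (tail ξ [r· s ^ e ]) i) (P e) n
          ≈⟨ +-congˡ (conv-scaleˡ (s ^ e) _ (P e) n) ⟩
        P e (suc n) + s ^ e * conv (tail ξ [r· s ^ e ]) (P e) n ∎

    -- The equation for ξ multiplied by P e after the substitution r ↦ r sᵉ.
    dilated-equation : ∀ {w d : Carrier} {a b : ℕ} →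
      (∀ n → ξ (suc n) + d * P a n ≈ w * P b n + d * P 1 n) →
      ∀ e n → conv (tail ξ [r· s ^ e ]) (P e) n + d * P (e ℕ.+ a) n ≈ w * P (e ℕ.+ b) n + d * P (suc e) n
    dilated-equation {w} {d} {a} {b} eq e n = begin
      conv (tail ξ [r· t ]) (P e) n + d * P (e ℕ.+ a) n
        ≈⟨ +-congˡ (scaled d a) ⟨
      conv (tail ξ [r· t ]) (P e) n + conv (λ i → d * (P a [r· t ]) i) (P e) n
        ≈⟨ conv-distribʳ (P e) _ _ n ⟨
      conv (addˢ (tail ξ [r· t ]) (λ i → d * (P a [r· t ]) i)) (P e) n
        ≈⟨ conv-cong dilated S.refl n ⟩
      conv (addˢ (λ i → w * (P b [r· t ]) i) (λ i → d * (P 1 [r· t ]) i)) (P e) n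
        ≈⟨ conv-distribʳ (P e) _ _ n ⟩
      conv (λ i → w * (P b [r· t ]) i) (P e) n + conv (λ i → d * (P 1 [r· t ]) i) (P e) n
        ≈⟨ +-cong (scaled w b) (scaled d 1) ⟩
      w * P (e ℕ.+ b) n + d * P (e ℕ.+ 1) n
        ≡⟨ ≡.cong (λ i → w * P (e ℕ.+ b) n + d * P i n) (ℕₚ.+-comm e 1) ⟩
      w * P (e ℕ.+ b) n + d * P (suc e) n ∎
      where
      t = s ^ e
      scaled : ∀ x i → conv (λ j → x * (P i [r· t ]) j) (P e) n ≈ x * P (e ℕ.+ i) n
      scaled x i = trans (conv-scaleˡ x _ (P e) n) (*-congˡ (sym (P-+ e i n)))
      dilated : ∀ i → (tail ξ [r· t ]) i + d * (P a [r· t ]) i ≈ w * (P b [r· t ]) i + d * (P 1 [r· t ]) i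
      dilated i = begin
        t ^ i * ξ (suc i) + d * (t ^ i * P a i)
          ≈⟨ solve 4 (λ t x d y → t :* x :+ d :* (t :* y) := t :* (x :+ d :* y)) refl (t ^ i) (ξ (suc i)) d (P a i) ⟩
        t ^ i * (ξ (suc i) + d * P a i) ≈⟨ *-congˡ (eq i) ⟩
        t ^ i * (w * P b i + d * P 1 i)
          ≈⟨ solve 5 (λ t w x d y → t :* (w :* x :+ d :* y) := w :* (t :* x) :+ d :* (t :* y)) refl (t ^ i) w (P b i) d (P 1 i) ⟩
        w * (t ^ i * P b i) + d * (t ^ i * P 1 i) ∎

-- Weighted completions of a path and their recurrence.

module Transfer {c ℓ} (R : CommutativeRing c ℓ) (k′ : ℕ) (s w w′ : CommutativeRing.Carrier R) where

  open CommutativeRing R hiding (zero; ring)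
  open Series R using (Seq; tail; conv)
  open Exp semiring
  open BigOps R using (∑)
  open Sums R
  open Dilation R using (module Products)
  open Weights R 0# 0# 0# using (_[r·_])
  open SetoidReasoning setoid
  open SemiringSolver commutativeSemiring using (solve; _:=_; _:+_; _:*_; con)
  open RingProperties (CommutativeRing.ring R) using (+-cancelʳ)

  private
    k = suc k′

  -- The same test as in `Valᴵᴵ`, so that `valleys 0` and `Valᴵᴵ k` agree by computation.
  short? : Decidable (λ p → 0 < p × p ≤ k ℕ.∸ 1)
  short? p = 0 ℕ.<? p ×-dec p ℕ.≤? k ℕ.∸ 1

  stepWeight : ℕ → Carrier
  stepWeight p = if does (short? p) then w′ else w

  -- Weight of the rest of a path, to be read from elevation e after p consecutive down steps.
  weight : ℕ → ℕ → Path → Carrier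
  weight zero    p []      = 1#
  weight (suc e) p []      = 0#
  weight e       p (U ∷ μ) = s ^ e * stepWeight p * weight (k ℕ.+ e) 0 μ
  weight zero    p (D ∷ μ) = 0#
  weight (suc e) p (D ∷ μ) = weight e (suc p) μ

  -- Allows sums over all words of a given length, which split freely by the first step.
  weight-nonreturning : ∀ e p μ → ¬ Returns k e μ → weight e p μ ≈ 0#
  weight-nonreturning zero    p []      ¬ret = contradiction done ¬ret
  weight-nonreturning (suc e) p []      ¬ret = refl
  weight-nonreturning zero    p (U ∷ μ) ¬ret =
    trans (*-congˡ (weight-nonreturning (k ℕ.+ 0) 0 μ (¬ret ∘ up))) (zeroʳ _)
  weight-nonreturning (suc e) p (U ∷ μ) ¬ret =
    trans (*-congˡ (weight-nonreturning (k ℕ.+ suc e) 0 μ (¬ret ∘ up))) (zeroʳ _)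
  weight-nonreturning zero    p (D ∷ μ) ¬ret = refl
  weight-nonreturning (suc e) p (D ∷ μ) ¬ret = weight-nonreturning e (suc p) μ (¬ret ∘ down)

  -- The length plays the role of the exponent of r: for l = e + (k + 1) n, only words with n up
  -- steps contribute, and this is the coefficient of rⁿ in F(e,p).
  total : ℕ → ℕ → ℕ → Carrier
  total l e p = ∑ (words l) (weight e p)

  total-U : ∀ l e p → ∑ (words l) (λ μ → weight e p (U ∷ μ)) ≈ s ^ e * stepWeight p * total l (k ℕ.+ e) 0
  total-U l zero    p = ∑-scale _ _ (words l)
  total-U l (suc e) p = ∑-scale _ _ (words l)

  total-short : ∀ {l e} p → l < e → total l e p ≈ 0#
  total-short {l} {e} p l<e = ∑-zero (All.map (λ {μ} len → weight-nonreturning e p μ (λ ret →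
    ℕₚ.<⇒≱ l<e (≡.subst (e ≤_) (≡.trans (≡.sym (Returns-length ret)) len) (ℕₚ.m≤m+n e _))))
    (words-length l))

  total-zero : ∀ l p → total (suc l) 0 p ≈ ∑ (words l) (λ μ → weight 0 p (U ∷ μ))
  total-zero l p = trans (∑-words-suc l _) (trans (+-congˡ (∑-zero (All.map (λ _ → refl) (words-length l)))) (+-identityʳ _))

  stepWeight-short : ∀ {q} → q < k′ → stepWeight (suc q) ≈ w′
  stepWeight-short {q} q<k′ rewrite dec-true (short? (suc q)) (s≤s z≤n , q<k′) = refl

  stepWeight-long : ∀ {p} → k ≤ p → stepWeight p ≈ w
  stepWeight-long {p} k≤p rewrite dec-false (short? p) (λ (_ , p≤) → ℕₚ.<⇒≱ k≤p p≤) = refl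

  valleys : ℕ → Path → ℕ
  valleys p μ = length (filter short? (valleySizesFrom p μ))

  valleys≤ups : ∀ p μ → valleys p μ ≤ ups μ
  valleys≤ups p       []      = z≤n
  valleys≤ups p       (D ∷ μ) = valleys≤ups (suc p) μ
  valleys≤ups zero    (U ∷ μ) = ℕₚ.m≤n⇒m≤1+n (valleys≤ups 0 μ)
  valleys≤ups (suc p) (U ∷ μ) with does (short? (suc p))
  ... | true  = s≤s (valleys≤ups 0 μ)
  ... | false = ℕₚ.m≤n⇒m≤1+n (valleys≤ups 0 μ)

  -- Path weights as monomials.

  module Monomial (τ x y : Carrier) (w≈τx : w ≈ τ * x) (w′≈τy : w′ ≈ τ * y) where

    -- The exponents are the elevation sum, the number of up steps, and the numbers of up steps that
    -- do not and do close a short valley. Later τ = -s.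
    monomial : ℕ → ℕ → ℕ → ℕ → Carrier
    monomial a n i j = s ^ a * (τ ^ n * (x ^ i * y ^ j))

    monomial-long : ∀ e a n i j → s ^ e * w * monomial a n i j ≈ monomial (e ℕ.+ a) (suc n) (suc i) j
    monomial-long e a n i j = begin
      s ^ e * w * monomial a n i j
        ≈⟨ *-congʳ (*-congˡ w≈τx) ⟩
      s ^ e * (τ * x) * monomial a n i j
        ≈⟨ solve 7 (λ s τ x s′ τ′ x′ y′ →
             s :* (τ :* x) :* (s′ :* (τ′ :* (x′ :* y′))) := (s :* s′) :* (τ :* τ′ :* (x :* x′ :* y′)))
             refl _ _ _ _ _ _ _ ⟩
      s ^ e * s ^ a * (τ ^ suc n * (x ^ suc i * y ^ j))
        ≈⟨ *-congʳ (^-homo-* s e a) ⟨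
      monomial (e ℕ.+ a) (suc n) (suc i) j ∎

    monomial-short : ∀ e a n i j → s ^ e * w′ * monomial a n i j ≈ monomial (e ℕ.+ a) (suc n) i (suc j)
    monomial-short e a n i j = begin
      s ^ e * w′ * monomial a n i j
        ≈⟨ *-congʳ (*-congˡ w′≈τy) ⟩
      s ^ e * (τ * y) * monomial a n i j
        ≈⟨ solve 7 (λ s τ y s′ τ′ x′ y′ →
             s :* (τ :* y) :* (s′ :* (τ′ :* (x′ :* y′))) := (s :* s′) :* (τ :* τ′ :* (x′ :* (y :* y′))))
             refl _ _ _ _ _ _ _ ⟩
      s ^ e * s ^ a * (τ ^ suc n * (x ^ i * y ^ suc j))
        ≈⟨ *-congʳ (^-homo-* s e a) ⟨
      monomial (e ℕ.+ a) (suc n) i (suc j) ∎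

    weight-monomial : ∀ {e} p {μ} → Returns k e μ →
      weight e p μ ≈ monomial (elevationSum k e μ) (ups μ) (ups μ ℕ.∸ valleys p μ) (valleys p μ)
    weight-monomial p done = solve 0 (con 1 := con 1 :* (con 1 :* (con 1 :* con 1))) refl
    weight-monomial p (down ret) = weight-monomial (suc p) ret
    weight-monomial p (up {e} {μ} ret) = begin
      weight e p (U ∷ μ)
        ≈⟨ weight-U e p ⟩
      s ^ e * stepWeight p * weight (k ℕ.+ e) 0 μ
        ≈⟨ *-congˡ (weight-monomial 0 ret) ⟩
      s ^ e * stepWeight p * monomial a n (n ℕ.∸ v) v
        ≈⟨ step p ⟩
      monomial (e ℕ.+ a) (suc n) (suc n ℕ.∸ valleys p (U ∷ μ)) (valleys p (U ∷ μ)) ∎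
      where
      a = elevationSum k (k ℕ.+ e) μ
      n = ups μ
      v = valleys 0 μ
      -- `weight` splits on the elevation first, so its clause for U computes only once e is a
      -- constructor.
      weight-U : ∀ e p → weight e p (U ∷ μ) ≈ s ^ e * stepWeight p * weight (k ℕ.+ e) 0 μ
      weight-U zero    p = refl
      weight-U (suc e) p = refl
      long : s ^ e * w * monomial a n (n ℕ.∸ v) v ≈ monomial (e ℕ.+ a) (suc n) (suc n ℕ.∸ v) v
      -- By `valleys≤ups`, `suc n ∸ v` is `suc (n ∸ v)`.
      long = trans (monomial-long e a n (n ℕ.∸ v) v)
        (reflexive (≡.cong (λ i → monomial (e ℕ.+ a) (suc n) i v) (≡.sym (ℕₚ.+-∸-assoc 1 (valleys≤ups 0 μ)))))
      step : ∀ p → s ^ e * stepWeight p * monomial a n (n ℕ.∸ v) v ≈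
                   monomial (e ℕ.+ a) (suc n) (suc n ℕ.∸ valleys p (U ∷ μ)) (valleys p (U ∷ μ))
      step zero = long
      step (suc p) with does (short? (suc p))
      ... | true  = monomial-short e a n (n ℕ.∸ v) v
      ... | false = long

  -- The closed form of the generating functions.

  module Solution (d : Carrier) (w′+d≈w : w′ + d ≈ w) (ξ : Seq) (ξ₀≈1 : ξ 0 ≈ 1#)
                  (equation : ∀ n → ξ (suc n) + d * Products.P s ξ k n ≈
                                    w * Products.P s ξ (suc k) n + d * Products.P s ξ 1 n) where

    open Products s ξ

    -- P (suc e) − P e = r sᵉ · K e, by P-suc-tail.
    K : ℕ → Seq
    K e = conv (tail ξ [r· s ^ e ]) (P e)

    -- The functional equation at r sᵉ times `P e`. It identifies `K e` with the closed form for w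
    -- F(k+e,0).
    K-equation : ∀ e n → K e n + d * P (k ℕ.+ e) n ≈ w * P (suc (k ℕ.+ e)) n + d * P (suc e) n
    K-equation e n = begin
      K e n + d * P (k ℕ.+ e) n ≡⟨ ≡.cong (λ i → K e n + d * P i n) (ℕₚ.+-comm k e) ⟩
      K e n + d * P (e ℕ.+ k) n ≈⟨ dilated-equation {w} {d} {k} {suc k} equation e n ⟩
      w * P (e ℕ.+ suc k) n + d * P (suc e) n
        ≡⟨ ≡.cong (λ i → w * P i n + d * P (suc e) n) (ℕₚ.+-comm e (suc k)) ⟩
      w * P (suc (k ℕ.+ e)) n + d * P (suc e) n ∎

    mutual

      -- The four lemmas of the block form one induction on the word length. Closed forms are
      -- multiplied by w, and `+-cancelʳ` stands in for subtraction. Here the next step is U, with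
      -- weight w since p = 0, or D, which opens a run of length 1; `K-equation` and w′ + d = w
      -- finish.
      total-afterU : ∀ l e n → l ≡ k ℕ.+ e ℕ.+ suc k ℕ.* n → w * total l (k ℕ.+ e) 0 ≈ K e n
      total-afterU (suc l) e n len = +-cancelʳ (w * P (k ℕ.+ e) n) _ _ (begin
        w * total (suc l) (k ℕ.+ e) 0 + w * P (k ℕ.+ e) n
          ≈⟨ +-congʳ (*-congˡ (∑-words-suc l _)) ⟩
        w * (∑ (words l) (λ μ → weight (k ℕ.+ e) 0 (U ∷ μ)) + total l (k′ ℕ.+ e) 1) + w * P (k ℕ.+ e) n
          ≈⟨ solve 4 (λ w a b x → w :* (a :+ b) :+ w :* x := (w :* a :+ w :* x) :+ w :* b) refl w _ _ _ ⟩
        (w * ∑ (words l) (λ μ → weight (k ℕ.+ e) 0 (U ∷ μ)) + w * P (k ℕ.+ e) n) + w * total l (k′ ℕ.+ e) 1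
          ≈⟨ +-cong (total-stepU l (k ℕ.+ e) 0 n len)
                    (total-afterD l (k′ ℕ.+ e) 0 n (ℕₚ.suc-injective len)
                       (≡.subst (k ≤_) (ℕₚ.+-comm 1 _) (s≤s (ℕₚ.m≤m+n k′ e)))) ⟩
        w * P (suc (k ℕ.+ e)) n + (w′ * P (k ℕ.+ e) n + d * P (suc (k′ ℕ.+ e ℕ.∸ k′)) n)
          ≡⟨ ≡.cong (λ i → w * P (suc (k ℕ.+ e)) n + (w′ * P (k ℕ.+ e) n + d * P (suc i) n)) (ℕₚ.m+n∸m≡n k′ e) ⟩
        w * P (suc (k ℕ.+ e)) n + (w′ * P (k ℕ.+ e) n + d * P (suc e) n)
          ≈⟨ solve 3 (λ x y z → x :+ (y :+ z) := (x :+ z) :+ y) refl _ _ _ ⟩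
        (w * P (suc (k ℕ.+ e)) n + d * P (suc e) n) + w′ * P (k ℕ.+ e) n
          ≈⟨ +-congʳ (K-equation e n) ⟨
        (K e n + d * P (k ℕ.+ e) n) + w′ * P (k ℕ.+ e) n
          ≈⟨ solve 4 (λ x d p w′ → (x :+ d :* p) :+ w′ :* p := x :+ (w′ :+ d) :* p) refl _ _ _ _ ⟩
        K e n + (w′ + d) * P (k ℕ.+ e) n
          ≈⟨ +-congˡ (*-congʳ w′+d≈w) ⟩
        K e n + w * P (k ℕ.+ e) n ∎)

      -- An up step leads to F(k+e,0) with factor r sᵉ · `stepWeight p`, and r sᵉ · `K e` telescopes
      -- to `P (suc e)` - `P e`.
      total-stepU : ∀ l e p n → suc l ≡ e ℕ.+ suc k ℕ.* n →
        w * ∑ (words l) (λ μ → weight e p (U ∷ μ)) + stepWeight p * P e n ≈ stepWeight p * P (suc e) n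
      -- The remaining word is too short to come down after another up step, and every `P` has
      -- constant term 1.
      total-stepU l e p zero len = begin
        w * ∑ (words l) (λ μ → weight e p (U ∷ μ)) + stepWeight p * P e 0
          ≈⟨ +-cong (*-congˡ (trans (total-U l e p) (*-congˡ (total-short 0 l<k+e))))
                    (*-congˡ (trans (P-head ξ₀≈1 e) (sym (P-head ξ₀≈1 (suc e))))) ⟩
        w * (s ^ e * stepWeight p * 0#) + stepWeight p * P (suc e) 0
          ≈⟨ solve 4 (λ w s v x → w :* (s :* v :* con 0) :+ v :* x := v :* x) refl _ _ _ _ ⟩
        stepWeight p * P (suc e) 0 ∎
        where
        l<k+e : l < k ℕ.+ e
        l<k+e = ≡.subst (_≤ k ℕ.+ e)
          (≡.sym (≡.trans len (≡.trans (≡.cong (e ℕ.+_) (ℕₚ.*-zeroʳ (suc k))) (ℕₚ.+-identityʳ e)))) (ℕₚ.m≤n+m e k)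
      total-stepU l e p (suc n) len = begin
        w * ∑ (words l) (λ μ → weight e p (U ∷ μ)) + stepWeight p * P e (suc n)
          ≈⟨ +-congʳ (*-congˡ (total-U l e p)) ⟩
        w * (s ^ e * stepWeight p * total l (k ℕ.+ e) 0) + stepWeight p * P e (suc n)
          ≈⟨ solve 5 (λ w s v t x → w :* (s :* v :* t) :+ v :* x := v :* (x :+ s :* (w :* t))) refl _ _ _ _ _ ⟩
        stepWeight p * (P e (suc n) + s ^ e * (w * total l (k ℕ.+ e) 0))
          ≈⟨ *-congˡ (+-congˡ (*-congˡ (total-afterU l e n (ℕₚ.suc-injective (≡.trans len (regroup k e n)))))) ⟩
        stepWeight p * (P e (suc n) + s ^ e * K e n)
          ≈⟨ *-congˡ (P-suc-tail ξ₀≈1 e n) ⟨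
        stepWeight p * P (suc e) (suc n) ∎
        where
        regroup : ∀ k e n → e ℕ.+ suc k ℕ.* suc n ≡ suc (k ℕ.+ e ℕ.+ suc k ℕ.* n)
        regroup = ℕ-Solver.solve-∀

      -- For q ≥ k′ the subtraction truncates and the right-hand side is w * P (suc e) n.
      total-afterD : ∀ l e q n → l ≡ e ℕ.+ suc k ℕ.* n → k ≤ e ℕ.+ suc q →
        w * total l e (suc q) ≈ w′ * P (suc e) n + d * P (suc (e ℕ.∸ (k′ ℕ.∸ q))) n
      total-afterD zero zero q zero len k≤ = begin
        w * (1# + 0#) ≈⟨ *-cong (sym w′+d≈w) (trans (+-identityʳ 1#) (sym (P-head ξ₀≈1 1))) ⟩
        (w′ + d) * P 1 0 ≈⟨ distribʳ _ _ _ ⟩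
        w′ * P 1 0 + d * P 1 0
          ≡⟨ ≡.cong (λ i → w′ * P 1 0 + d * P (suc i) 0) (≡.sym (ℕₚ.0∸n≡0 (k′ ℕ.∸ q))) ⟩
        w′ * P 1 0 + d * P (suc (0 ℕ.∸ (k′ ℕ.∸ q))) 0 ∎
      total-afterD (suc l) zero q zero    len k≤ = contradiction (≡.trans len (ℕₚ.*-zeroʳ (suc k))) λ ()
      total-afterD (suc l) zero q (suc n) len k≤ = begin
        w * total (suc l) 0 (suc q) ≈⟨ *-congˡ (total-zero l (suc q)) ⟩
        w * ∑ (words l) (λ μ → weight 0 (suc q) (U ∷ μ)) ≈⟨ +-identityʳ _ ⟨
        -- `P 0` is the series 1, so its coefficient at r^(n+1) is 0.
        w * ∑ (words l) (λ μ → weight 0 (suc q) (U ∷ μ)) + 0# ≈⟨ +-congˡ (zeroʳ _) ⟨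
        w * ∑ (words l) (λ μ → weight 0 (suc q) (U ∷ μ)) + stepWeight (suc q) * P 0 (suc n)
          ≈⟨ total-stepU l 0 (suc q) (suc n) len ⟩
        stepWeight (suc q) * P 1 (suc n)
          -- At elevation 0 the hypothesis reads k ≤ suc q: the run of down steps is long.
          ≈⟨ *-congʳ (trans (stepWeight-long k≤) (sym w′+d≈w)) ⟩
        (w′ + d) * P 1 (suc n) ≈⟨ distribʳ _ _ _ ⟩
        w′ * P 1 (suc n) + d * P 1 (suc n)
          ≡⟨ ≡.cong (λ i → w′ * P 1 (suc n) + d * P (suc i) (suc n)) (≡.sym (ℕₚ.0∸n≡0 (k′ ℕ.∸ q))) ⟩
        w′ * P 1 (suc n) + d * P (suc (0 ℕ.∸ (k′ ℕ.∸ q))) (suc n) ∎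
      total-afterD (suc l) (suc e) q n len k≤ with q ℕ.<? k′
      -- A down step preserves e + p, hence also the index of the d term. The w′ terms coming from U
      -- and from D cancel.
      ... | yes q<k′ = +-cancelʳ (w′ * P (suc e) n) _ _ (begin
        w * total (suc l) (suc e) (suc q) + w′ * P (suc e) n
          ≈⟨ +-congˡ (*-congʳ (stepWeight-short q<k′)) ⟨
        w * total (suc l) (suc e) (suc q) + stepWeight (suc q) * P (suc e) n
          ≈⟨ total-split l e q n len k≤ ⟩
        stepWeight (suc q) * P (suc (suc e)) n + (w′ * P (suc e) n + d * P (suc (e ℕ.∸ (k′ ℕ.∸ suc q))) n)
          ≈⟨ +-congʳ (*-congʳ (stepWeight-short q<k′)) ⟩
        w′ * P (suc (suc e)) n + (w′ * P (suc e) n + d * P (suc (e ℕ.∸ (k′ ℕ.∸ suc q))) n)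
          ≡⟨ ≡.cong (λ i → w′ * P (suc (suc e)) n + (w′ * P (suc e) n + d * P (suc (suc e ℕ.∸ i)) n))
                    (ℕₚ.+-∸-assoc 1 q<k′) ⟨
        w′ * P (suc (suc e)) n + (w′ * P (suc e) n + d * P (suc (suc e ℕ.∸ (k′ ℕ.∸ q))) n)
          ≈⟨ solve 3 (λ x y z → x :+ (y :+ z) := (x :+ z) :+ y) refl _ _ _ ⟩
        (w′ * P (suc (suc e)) n + d * P (suc (suc e ℕ.∸ (k′ ℕ.∸ q))) n) + w′ * P (suc e) n ∎)
      -- The run already has length at least k, so both subtractions are 0 and w′ + d recombines to
      -- w.
      ... | no q≮k′ = +-cancelʳ (w * P (suc e) n) _ _ (begin
        w * total (suc l) (suc e) (suc q) + w * P (suc e) n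
          ≈⟨ +-congˡ (*-congʳ long) ⟨
        w * total (suc l) (suc e) (suc q) + stepWeight (suc q) * P (suc e) n
          ≈⟨ total-split l e q n len k≤ ⟩
        stepWeight (suc q) * P (suc (suc e)) n + (w′ * P (suc e) n + d * P (suc (e ℕ.∸ (k′ ℕ.∸ suc q))) n)
          ≡⟨ ≡.cong (λ i → stepWeight (suc q) * P (suc (suc e)) n + (w′ * P (suc e) n + d * P (suc (e ℕ.∸ i)) n))
                    (ℕₚ.m≤n⇒m∸n≡0 (ℕₚ.m≤n⇒m≤1+n k′≤q)) ⟩
        stepWeight (suc q) * P (suc (suc e)) n + (w′ * P (suc e) n + d * P (suc e) n)
          ≈⟨ +-cong (*-congʳ (trans long (sym w′+d≈w)))
                    (trans (sym (distribʳ _ _ _)) (*-congʳ w′+d≈w)) ⟩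
        (w′ + d) * P (suc (suc e)) n + w * P (suc e) n
          ≈⟨ +-congʳ (distribʳ _ _ _) ⟩
        (w′ * P (suc (suc e)) n + d * P (suc (suc e)) n) + w * P (suc e) n
          ≡⟨ ≡.cong (λ i → (w′ * P (suc (suc e)) n + d * P (suc (suc e ℕ.∸ i)) n) + w * P (suc e) n)
                    (ℕₚ.m≤n⇒m∸n≡0 k′≤q) ⟨
        (w′ * P (suc (suc e)) n + d * P (suc (suc e ℕ.∸ (k′ ℕ.∸ q))) n) + w * P (suc e) n ∎)
        where
        k′≤q = ℕₚ.≮⇒≥ q≮k′
        long = stepWeight-long (s≤s k′≤q)

      -- The split by the first step, common to short and long runs. The bound k ≤ e + p holds when
      -- a run starts, since an up step ends at elevation at least k, and down steps preserve e + p.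
      total-split : ∀ l e q n → suc l ≡ suc e ℕ.+ suc k ℕ.* n → k ≤ suc e ℕ.+ suc q →
        w * total (suc l) (suc e) (suc q) + stepWeight (suc q) * P (suc e) n ≈
        stepWeight (suc q) * P (suc (suc e)) n + (w′ * P (suc e) n + d * P (suc (e ℕ.∸ (k′ ℕ.∸ suc q))) n)
      total-split l e q n len k≤ = begin
        w * total (suc l) (suc e) (suc q) + stepWeight (suc q) * P (suc e) n
          ≈⟨ +-congʳ (*-congˡ (∑-words-suc l _)) ⟩
        w * (∑ (words l) (λ μ → weight (suc e) (suc q) (U ∷ μ)) + total l e (suc (suc q))) + stepWeight (suc q) * P (suc e) n
          ≈⟨ solve 4 (λ w a b x → w :* (a :+ b) :+ x := (w :* a :+ x) :+ w :* b) refl w _ _ _ ⟩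
        (w * ∑ (words l) (λ μ → weight (suc e) (suc q) (U ∷ μ)) + stepWeight (suc q) * P (suc e) n) + w * total l e (suc (suc q))
          ≈⟨ +-cong (total-stepU l (suc e) (suc q) n len)
                    (total-afterD l e (suc q) n (ℕₚ.suc-injective len)
                       (≡.subst (k ≤_) (≡.sym (ℕₚ.+-suc e (suc q))) k≤)) ⟩
        stepWeight (suc q) * P (suc (suc e)) n + (w′ * P (suc e) n + d * P (suc (e ℕ.∸ (k′ ℕ.∸ suc q))) n) ∎

    -- A nonempty Dyck path starts with U from elevation 0, so F(0,0) = 1 + r w F(k,0), and
    -- `total-afterU` applies with e = 0.
    total-0 : ∀ n → total (k ℕ.* n ℕ.+ n) 0 0 ≈ ξ n
    total-0 n = ≡.subst (λ l → total l 0 0 ≈ ξ n) (ℕₚ.+-comm n (k ℕ.* n)) (by-size n)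
      where
      by-size : ∀ n → total (suc k ℕ.* n) 0 0 ≈ ξ n
      by-size zero    = ≡.subst (λ l → total l 0 0 ≈ ξ 0) (≡.sym (ℕₚ.*-zeroʳ (suc k))) (trans (+-identityʳ 1#) (sym ξ₀≈1))
      by-size (suc n) = begin
        total (suc l) 0 0                            ≈⟨ total-zero l 0 ⟩
        ∑ (words l) (λ μ → weight 0 0 (U ∷ μ))       ≈⟨ total-U l 0 0 ⟩
        1# * w * total l (k ℕ.+ 0) 0                 ≈⟨ *-congʳ (*-identityˡ w) ⟩
        w * total l (k ℕ.+ 0) 0                      ≈⟨ total-afterU l 0 n (regroup k n) ⟩
        -- `K 0` is `tail ξ`, because s⁰ = 1 and `P 0` = 1.
        K 0 n                                        ≈⟨ Series.conv-identityʳ R _ n ⟩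
        (tail ξ [r· 1# ]) n                          ≈⟨ Dilation.dilate-1 R (tail ξ) n ⟩
        ξ (suc n)                                    ∎
        where
        l = n ℕ.+ k ℕ.* suc n
        regroup : ∀ k n → n ℕ.+ k ℕ.* suc n ≡ k ℕ.+ 0 ℕ.+ suc k ℕ.* n
        regroup = ℕ-Solver.solve-∀

-- From the functional equation to the expansion over Dyck paths.

module Functional {c ℓ} (R : CommutativeRing c ℓ) (m s u : CommutativeRing.Carrier R) where

  open CommutativeRing R hiding (zero; ring)
  open Series R using (Seq; conv; const; var; _≋_)
  open Exp semiring
  open CExp commutativeSemiring using (^-distrib-*)
  open BigOps R using (∑)
  open Sums R
  open Dilation R
  open Weights R m s u
  open RingProperties (CommutativeRing.ring R) using (-‿distribˡ-*; -0#≈0#)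
  open SetoidReasoning setoid
  open SemiringSolver commutativeSemiring using (solve; _:=_; _:+_; _:*_; con)
  private
    module S where
      open CommutativeRing (Series.ring R) public
      open SemiringSolver (CommutativeRing.commutativeSemiring (Series.ring R)) public
        using (solve; _:=_; _:+_; _:*_; con)

  private
    -- `x` equals m u, but is kept in the form that occurs in `wtᴵᴵ`; `restore-1` converts it.
    x y w w′ d : Carrier
    x = (m′ + 1#) * (u′ + 1#)
    y = m′ * u′ + u′ + 1#
    w = - s * x
    w′ = - s * y
    d = - s * m′

  restore-1 : ∀ a → (a - 1#) + 1# ≈ a
  restore-1 a = trans (+-assoc a _ _) (trans (+-congˡ (-‿inverseˡ 1#)) (+-identityʳ a))

  const-m′ : const m S.- S.1# ≋ const m′
  const-m′ zero    = refl
  const-m′ (suc n) = -‿inverseʳ 0#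

  -- Because y + m′ = (m′ + 1)(u′ + 1) = x.
  w′+d≈w : w′ + d ≈ w
  w′+d≈w = solve 3 (λ t a b → t :* (a :* b :+ b :+ con 1) :+ t :* a := t :* ((a :+ con 1) :* (b :+ con 1)))
             refl (- s) m′ u′

  wtᴵᴵ-power : ∀ k n μ → wtᴵᴵ n k μ ≈ x ^ (n ℕ.∸ Valᴵᴵ k μ) * y ^ Valᴵᴵ k μ
  wtᴵᴵ-power k n μ = *-congʳ (sym (^-distrib-* _ _ (n ℕ.∸ Valᴵᴵ k μ)))

  module _ (k′ : ℕ) (ξ : Seq) where

    open Products s ξ
    private
      k = suc k′

    -- Over ℤ[m,s,u] this unfolds to the hypothesis of the theorem.
    FunctionalEquation : Set ℓ
    FunctionalEquation =
      (S.1# S.+ var S.* const s S.* (const m S.- S.1#)) S.* ξ S.≈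
      S.1# S.+ var S.* const s S.* (const m S.- S.1#) S.* P k S.- const m S.* var S.* const s S.* const u S.* P (suc k)

    module _ (functional : FunctionalEquation) where

      private
        G₁ G₂ G₃ : Seq
        G₁ = const s S.* ((const m S.- S.1#) S.* ξ)
        G₂ = const s S.* ((const m S.- S.1#) S.* P k)
        G₃ = const s S.* (const m S.* (const u S.* P (suc k)))

      -- With r pulled to the front of every product, coefficients are read off by `conv-var-zero`
      -- and `conv-var-suc`.
      factored : ξ S.+ var S.* G₁ S.≈ S.1# S.+ var S.* G₂ S.- var S.* G₃
      factored = S.trans (S.trans
        (S.solve 4 (λ r s m ξ → ξ S.:+ r S.:* (s S.:* (m S.:* ξ)) S.:= (S.con 1 S.:+ r S.:* s S.:* m) S.:* ξ)
           S.refl var (const s) (const m S.- S.1#) ξ)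
        functional)
        (S.+-cong
          (S.+-congˡ {S.1#} (S.solve 4 (λ r s m ξ → r S.:* s S.:* m S.:* ξ S.:= r S.:* (s S.:* (m S.:* ξ)))
             S.refl var (const s) (const m S.- S.1#) (P k)))
          (S.-‿cong (S.solve 5 (λ r s m u ξ → m S.:* r S.:* s S.:* u S.:* ξ S.:= r S.:* (s S.:* (m S.:* (u S.:* ξ))))
             S.refl var (const s) (const m) (const u) (P (suc k)))))

      ξ-zero : ξ 0 ≈ 1#
      ξ-zero = begin
        ξ 0                                      ≈⟨ +-identityʳ _ ⟨
        ξ 0 + 0#                                 ≈⟨ +-congˡ (conv-var-zero G₁) ⟨
        ξ 0 + conv var G₁ 0                      ≈⟨ factored 0 ⟩
        1# + conv var G₂ 0 - conv var G₃ 0       ≈⟨ +-cong (+-congˡ (conv-var-zero G₂)) (-‿cong (conv-var-zero G₃)) ⟩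
        1# + 0# - 0#                             ≈⟨ +-cong (+-identityʳ 1#) -0#≈0# ⟩
        1# + 0#                                  ≈⟨ +-identityʳ 1# ⟩
        1#                                       ∎

      G₁-coeff : ∀ g n → (const s S.* ((const m S.- S.1#) S.* g)) n ≈ s * (m′ * g n)
      G₁-coeff g n = trans (conv-const s _ n)
        (*-congˡ (trans (S.*-congʳ {g} const-m′ n) (conv-const m′ g n)))

      G₃-coeff : ∀ n → G₃ n ≈ s * (m * (u * P (suc k) n))
      G₃-coeff n = trans (conv-const s _ n) (*-congˡ (trans (conv-const m _ n) (*-congˡ (conv-const u _ n))))

      ξ-suc : ∀ n → ξ (suc n) + s * (m′ * ξ n) ≈ s * (m′ * P k n) + - s * (m * (u * P (suc k) n))
      ξ-suc n = begin
        ξ (suc n) + s * (m′ * ξ n)                   ≈⟨ +-congˡ (trans (conv-var-suc G₁ n) (G₁-coeff ξ n)) ⟨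
        ξ (suc n) + conv var G₁ (suc n)              ≈⟨ factored (suc n) ⟩
        0# + conv var G₂ (suc n) - conv var G₃ (suc n)
          ≈⟨ +-cong (trans (+-identityˡ _) (trans (conv-var-suc G₂ n) (G₁-coeff (P k) n)))
                    (trans (-‿cong (trans (conv-var-suc G₃ n) (G₃-coeff n))) (-‿distribˡ-* s _)) ⟩
        s * (m′ * P k n) + - s * (m * (u * P (suc k) n)) ∎

      -- `ξ-suc` rewritten with d = -s m′ and w = -s m u, and with the terms in d moved across; ξ
      -- becomes `P 1`.
      equation : ∀ n → ξ (suc n) + d * P k n ≈ w * P (suc k) n + d * P 1 n
      equation n = begin
        ξ (suc n) + d * P k n
          ≈⟨ +-identityʳ _ ⟨
        (ξ (suc n) + d * P k n) + 0#
          -- The solver treats `- s` as an atom, so multiples of s + (-s) are inserted here and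
          -- removed below by hand.
          ≈⟨ +-congˡ (cancelled (m′ * ξ n)) ⟨
        (ξ (suc n) + - s * m′ * P k n) + (s + - s) * (m′ * ξ n)
          ≈⟨ solve 6 (λ a s t m p q → (a :+ t :* m :* p) :+ (s :+ t) :* (m :* q)
                                   := (a :+ s :* (m :* q)) :+ (t :* m :* p :+ t :* m :* q)) refl _ s (- s) m′ (P k n) (ξ n) ⟩
        (ξ (suc n) + s * (m′ * ξ n)) + (d * P k n + d * ξ n)
          ≈⟨ +-congʳ (ξ-suc n) ⟩
        (s * (m′ * P k n) + - s * (m * (u * P (suc k) n))) + (d * P k n + d * ξ n)
          ≈⟨ solve 8 (λ s t m p q a b c → (s :* (m :* p) :+ t :* (a :* (b :* c))) :+ (t :* m :* p :+ t :* m :* q)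
                                   := (t :* (a :* b) :* c :+ t :* m :* q) :+ (s :+ t) :* (m :* p))
               refl s (- s) m′ (P k n) (ξ n) m u (P (suc k) n) ⟩
        (- s * (m * u) * P (suc k) n + d * ξ n) + (s + - s) * (m′ * P k n)
          ≈⟨ +-congˡ (cancelled (m′ * P k n)) ⟩
        (- s * (m * u) * P (suc k) n + d * ξ n) + 0#
          ≈⟨ +-identityʳ _ ⟩
        - s * (m * u) * P (suc k) n + d * ξ n
          ≈⟨ +-cong (*-congʳ (*-congˡ (*-cong (restore-1 m) (restore-1 u)))) (*-congˡ (P-one n)) ⟨
        w * P (suc k) n + d * P 1 n ∎
        where
        cancelled : ∀ z → (s + - s) * z ≈ 0#
        cancelled z = trans (*-congʳ (-‿inverseʳ s)) (zeroˡ z)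

      open Transfer R k′ s w w′
      open Solution d w′+d≈w ξ ξ-zero equation
      open Monomial (- s) x y refl refl

      -- With the area as an elevation sum, the summand is a reordering of the monomial of
      -- `weight-monomial`.
      dyck-weight : ∀ {n μ} → IsDyck n k μ → (- s) ^ n * (s ^ area n k μ * wtᴵᴵ n k μ) ≈ weight 0 0 μ
      dyck-weight {n} {μ} dyck@(isDyck _ ups≡n _) = begin
        (- s) ^ n * (s ^ area n k μ * wtᴵᴵ n k μ)
          ≈⟨ *-congˡ (*-cong (^-congʳ s (area≡elevationSum dyck)) (wtᴵᴵ-power k n μ)) ⟩
        (- s) ^ n * (s ^ elevationSum k 0 μ * (x ^ (n ℕ.∸ Valᴵᴵ k μ) * y ^ Valᴵᴵ k μ))
          ≈⟨ solve 3 (λ a b c → a :* (b :* c) := b :* (a :* c)) refl _ _ _ ⟩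
        monomial (elevationSum k 0 μ) n (n ℕ.∸ Valᴵᴵ k μ) (Valᴵᴵ k μ)
          ≡⟨ ≡.cong (λ i → monomial (elevationSum k 0 μ) i (i ℕ.∸ Valᴵᴵ k μ) (Valᴵᴵ k μ)) ups≡n ⟨
        monomial (elevationSum k 0 μ) (ups μ) (ups μ ℕ.∸ Valᴵᴵ k μ) (Valᴵᴵ k μ)
          ≈⟨ weight-monomial 0 (IsDyck⇒Returns dyck) ⟨
        weight 0 0 μ ∎

      -- Words of length k n + n that are not Dyck paths have weight 0, so the sum over `Dyck n k`
      -- is `total` from elevation 0.
      expansion : ξ ≋ (λ n → ∑ (Dyck n k) (λ μ → s ^ area n k μ * wtᴵᴵ n k μ)) [r· - s ]
      expansion n = sym (begin
        (- s) ^ n * ∑ (Dyck n k) (λ μ → s ^ area n k μ * wtᴵᴵ n k μ)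
          ≈⟨ ∑-scale ((- s) ^ n) _ (Dyck n k) ⟨
        ∑ (Dyck n k) (λ μ → (- s) ^ n * (s ^ area n k μ * wtᴵᴵ n k μ))
          ≈⟨ ∑-filter (isDyck? n k) (All.map
               (λ {μ} len → dyck-weight , λ ¬dyck → weight-nonreturning 0 0 μ (¬dyck ∘ Returns⇒IsDyck len))
               (words-length (k ℕ.* n ℕ.+ n))) ⟩
        total (k ℕ.* n ℕ.+ n) 0 0
          ≈⟨ total-0 n ⟩
        ξ n ∎)

open import Defs

proposition4p25 : (k : ℕ) → 2 ≤ k → (ξ : PowerSeries) →
  f (r * s) * ξ ≈ 1# + r * s * (m - 1#) * ∏< k (λ j → ξ [r· sᶜ Coeff.^ j ])
                     - m * r * s * u * ∏< (suc k) (λ j → ξ [r· sᶜ Coeff.^ j ]) →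
  ξ ≈ (λ n → Coeff.∑ (Dyck n k) (λ μ → sᶜ Coeff.^ area n k μ Coeff.* wtᴵᴵ n k μ)) [r· Coeff.- sᶜ ]
proposition4p25 (suc k′) _ ξ functional = Functional.expansion ℤ[m,s,u] mᶜ sᶜ uᶜ k′ ξ functional
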